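{- Let $\lambda, m, n$ be positive integers. Let $V(\lambda m K_n)=\mathbb{Z}_n$ and $V(\lambda K_{n\times m})=\bigcup_{i\in\mathbb{Z}_n}V_i$, where $V_0,V_1,\ldots,V_{n-1}$ are the parts of $\lambda K_{n\times m}$, each of size $m$. Suppose $\mathcal{D}=\{C_1,\ldots,C_k\}$ is a cycle decomposition of $\lambda m K_n$ (where, if $\lambda m(n-1)$ is odd, the decomposition additionally contains a single 1-factor besides the cycles $C_1,\ldots,C_k$). Then there exists a cycle decomposition $\mathcal{D}'=\{C_1',\ldots,C_k'\}$ of $\lambda K_{n\times m}$ (together with a single 1-factor if $\lambda m(n-1)$ is odd) such that $V(C_i')=\bigcup_{j\in V(C_i)}V_j$ for each $i\in\{1,\ldots,k\}$.
   Context: Graphs may have parallel edges. $\lambda K_n$ is the complete multigraph on $n$ vertices in which every pair of distinct vertices is joined by $\lambda$ parallel edges; $\lambda K_{n\times m}$ is the complete $\lambda$-fold $n$-partite multigraph with $n$ parts of size $m$ (two vertices in distinct parts are joined by $\lambda$ parallel edges, vertices in the same part are nonadjacent). A cycle decomposition of a graph $\mathcal{G}$ is a partition of its edge set into cycles (cycles of length 2, i.e. pairs of parallel edges, are allowed in multigraphs), or into cycles and a single 1-factor in case every vertex of $\mathcal{G}$ has odd degree. -}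

module Defs where

open import Data.Nat using (ℕ; zero; suc; _+_; _*_; _∸_; _≤_; _%_; _≡ᵇ_)
open import Data.Bool using (Bool; true; false; if_then_else_)
open import Data.Fin using (Fin)
open import Data.Fin.Properties using () renaming (_≟_ to _≟F_)
open import Data.List using (List; []; _∷_; _++_; [_]; length; filter; zip)
open import Data.List.Relation.Unary.Unique.Propositional using (Unique)
open import Data.Vec using (Vec)
import Data.Vec as Vec
open import Data.Product using (Σ; _×_; _,_; proj₁; proj₂)
open import Data.Product.Properties using (≡-dec)
open import Data.Sum using (_⊎_)
open import Data.Unit using (⊤)
open import Relation.Binary.PropositionalEquality using (_≡_; _≢_)
open import Relation.Binary.Definitions using (DecidableEquality)
open import Relation.Nullary using (yes; no)
open import Relation.Nullary.Decidable using (_×-dec_; _⊎-dec_)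

-- A (loopless) multigraph on vertex type V is given by its edge multiplicity
-- function: mult u v = number of parallel edges joining distinct u and v.
Multigraph : Set → Set
Multigraph V = V → V → ℕ

-- A cycle is given by its cyclic sequence of distinct vertices v0 … v(l-1),
-- l ≥ 2; its edges are v(i) v(i+1) (indices mod l).  For l = 2 this is the
-- 2-cycle consisting of two parallel edges between v0 and v1.
record Cycle (V : Set) : Set where
  constructor mkCycle
  field
    verts    : List V
    distinct : Unique verts
    len≥2    : 2 ≤ length verts
open Cycle public

rotate : {V : Set} → List V → List V
rotate []       = []
rotate (x ∷ xs) = xs ++ [ x ]

cycleEdges : {V : Set} → List V → List (V × V)
cycleEdges vs = zip vs (rotate vs)

module _ {V : Set} (_≟_ : DecidableEquality V) where

  edgeCount : V → V → Cycle V → ℕ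
  edgeCount u v C =
    length (filter (λ e → ((proj₁ e ≟ u) ×-dec (proj₂ e ≟ v))
                          ⊎-dec ((proj₁ e ≟ v) ×-dec (proj₂ e ≟ u)))
                   (cycleEdges (verts C)))

  -- a 1-factor of G given as a fixed-point-free involution f (the matching
  -- edges are {x , f x}), each matched pair being adjacent in G
  IsOneFactor : Multigraph V → (V → V) → Set
  IsOneFactor G f = (∀ x → f (f x) ≡ x) × (∀ x → f x ≢ x) × (∀ x → 1 ≤ G x (f x))

  OneFactor : Multigraph V → Set
  OneFactor G = Σ (V → V) (IsOneFactor G)

  factorCount : {G : Multigraph V} → OneFactor G → V → V → ℕ
  factorCount (f , _) u v with f u ≟ v
  ... | yes _ = 1
  ... | no  _ = 0

  FactorSlot : Multigraph V → Bool → Set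
  FactorSlot G true  = OneFactor G
  FactorSlot G false = ⊤

  slotCount : {G : Multigraph V} (b : Bool) → FactorSlot G b → V → V → ℕ
  slotCount {G} true  F u v = factorCount {G} F u v
  slotCount     false _ u v = 0

  record CycleDecomposition (G : Multigraph V) (hasFactor : Bool) (k : ℕ) : Set where
    field
      cycles : Vec (Cycle V) k
      factor : FactorSlot G hasFactor
      covers : ∀ u v → u ≢ v →
        Vec.sum (Vec.map (edgeCount u v) cycles)
          + slotCount {G} hasFactor factor u v
          ≡ G u v

  open CycleDecomposition public

λmKn : (lam m n : ℕ) → Multigraph (Fin n)
λmKn lam m n u v = lam * m

-- λ K_{n×m} on vertex set Fin n × Fin m; the part V_i is {i} × Fin m
λKnm : (lam n m : ℕ) → Multigraph (Fin n × Fin m)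
λKnm lam n m (a , _) (c , _) with a ≟F c
... | yes _ = 0
... | no  _ = lam

_≟V_ : {n m : ℕ} → DecidableEquality (Fin n × Fin m)
_≟V_ = ≡-dec _≟F_ _≟F_

oddDeg : (lam m n : ℕ) → Bool
oddDeg lam m n = (lam * m * (n ∸ 1)) % 2 ≡ᵇ 1

{-# OPTIONS --safe #-}

-- Amalgamation and detachment.  Traversing every cycle m times and every factor edge m times turns the
-- decomposition into one of the graph in which each part V_a is amalgamated into a single vertex of weight m:
-- a vertex u is visited w u times by each closed walk through its part, and u and v are joined by K u v * w u * w v
-- edges.  A vertex α of weight g ≥ 2 is split by moving one unit of weight to a new vertex α'.  A walk visiting
-- α g times consists of g excursions from α; if α' takes over one end of each of two different excursions E and E',
-- then the walk can be rearranged (reversing E and E' if necessary) into the single closed walk α E α' E' α ….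
-- The ends have to be chosen such that exactly a 1/g fraction of the edges from α to each other vertex is moved.
-- Give each excursion a row of g entries, its two end vertices and g − 2 spare slots of its walk, and give the
-- neighbours of α in the factor one more row of g entries.  A choice of one entry from every row that hits every
-- value with 1/g of its total frequency selects two excursions of each walk, as needed.  It exists because the
-- entries within rows can be permuted until all g columns have the same content: an Euler orientation of the graph
-- whose edges are the pairs of entries in two given columns tells which pairs to swap to equalize these two columns.

module Submission where

open import Defs
open import Data.Bool using (Bool; true; false; if_then_else_)
open import Data.Empty using (⊥-elim)
open import Data.Fin using (Fin; zero; suc; toℕ; fromℕ<)
open import Data.Fin.Properties using (_≟_; toℕ<n; toℕ-fromℕ<; toℕ-injective)
import Data.Fin.Properties as Fin
open import Data.List using (List; []; _∷_; _++_; [_]; length; map; filter; zip; concatMap; allFin; reverse; cartesianProduct)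
import Data.List.Properties as List
open import Data.List.Membership.Propositional using (_∈_; find; lose)
open import Data.List.Membership.Propositional.Properties using (∈-allFin; ∈-map⁺; ∈-cartesianProduct⁺; ∈-++⁺ˡ; ∈-++⁺ʳ)
open import Data.List.Relation.Binary.Pointwise using (Pointwise; []; _∷_) renaming (++⁺ to Pointwise-++⁺)
open import Data.List.Relation.Unary.All using (All; []; _∷_)
import Data.List.Relation.Unary.All as All
open import Data.List.Relation.Unary.AllPairs using ([]; _∷_)
open import Data.List.Relation.Unary.Any using (here; there; any?)
open import Data.List.Relation.Unary.Unique.Propositional using (Unique)
open import Data.Nat using (ℕ; zero; suc; _+_; _*_; _∸_; _≤_; _<_; z≤n; s≤s; _≤?_; _<?_)
open import Data.Nat.Properties hiding (_≟_)
open import Data.Nat.Tactic.RingSolver using (solve-∀)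
open import Data.Product using (Σ; ∃; _×_; _,_; proj₁; proj₂; swap; uncurry)
open import Data.Sum using (_⊎_; inj₁; inj₂)
open import Data.Sum.Properties using (inj₁-injective; inj₂-injective) renaming (≡-dec to ⊎-≡-dec)
open import Data.Vec using (Vec; lookup)
import Data.Vec as Vec
open import Data.Vec.Properties using (lookup∘tabulate)
open import Function using (_∘_)
open import Function.Bundles using (_⇔_; mk⇔; Equivalence)
open import Relation.Binary.Definitions using (DecidableEquality; tri<; tri≈; tri>)
open import Relation.Binary.PropositionalEquality hiding ([_])
open import Relation.Nullary using (Dec; yes; no; does; ¬_; contradiction)
open import Relation.Nullary.Decidable using (_×-dec_; _⊎-dec_)

private variable
  A B : Set

-- Sums over lists and indicator functions

sumL : (A → ℕ) → List A → ℕ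
sumL f []       = 0
sumL f (x ∷ xs) = f x + sumL f xs

⟦_⟧ : {P : Set} → Dec P → ℕ
⟦ d ⟧ = if does d then 1 else 0

⟦yes⟧ : {P : Set} (d : Dec P) → P → ⟦ d ⟧ ≡ 1
⟦yes⟧ (yes _) p = refl
⟦yes⟧ (no ¬p) p = contradiction p ¬p

⟦no⟧ : {P : Set} (d : Dec P) → ¬ P → ⟦ d ⟧ ≡ 0
⟦no⟧ (yes p) ¬p = contradiction p ¬p
⟦no⟧ (no _)  _  = refl

⟦⟧-⇔ : {P Q : Set} (d : Dec P) (e : Dec Q) → (P → Q) → (Q → P) → ⟦ d ⟧ ≡ ⟦ e ⟧
⟦⟧-⇔ (yes p) e pq qp = sym (⟦yes⟧ e (pq p))
⟦⟧-⇔ (no ¬p) e pq qp = sym (⟦no⟧ e (¬p ∘ qp))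

sumL-cong : {f g : A → ℕ} → (∀ x → f x ≡ g x) → ∀ xs → sumL f xs ≡ sumL g xs
sumL-cong e []       = refl
sumL-cong e (x ∷ xs) = cong₂ _+_ (e x) (sumL-cong e xs)

sumL-congAll : {f g : A → ℕ} {xs : List A} → All (λ x → f x ≡ g x) xs → sumL f xs ≡ sumL g xs
sumL-congAll []       = refl
sumL-congAll (e ∷ es) = cong₂ _+_ e (sumL-congAll es)

sumL-0 : (xs : List A) → sumL (λ _ → 0) xs ≡ 0
sumL-0 []       = refl
sumL-0 (x ∷ xs) = sumL-0 xs

sumL-++ : (f : A → ℕ) (xs ys : List A) → sumL f (xs ++ ys) ≡ sumL f xs + sumL f ys
sumL-++ f []       ys = refl
sumL-++ f (x ∷ xs) ys rewrite sumL-++ f xs ys = sym (+-assoc (f x) _ _)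

sumL-map : (f : B → ℕ) (h : A → B) (xs : List A) → sumL f (map h xs) ≡ sumL (f ∘ h) xs
sumL-map f h []       = refl
sumL-map f h (x ∷ xs) = cong (f (h x) +_) (sumL-map f h xs)

sumL-concatMap : (f : B → ℕ) (h : A → List B) (xs : List A) →
  sumL f (concatMap h xs) ≡ sumL (λ x → sumL f (h x)) xs
sumL-concatMap f h []       = refl
sumL-concatMap f h (x ∷ xs) =
  trans (sumL-++ f (h x) (concatMap h xs)) (cong (sumL f (h x) +_) (sumL-concatMap f h xs))

interchange : ∀ a b c d → (a + b) + (c + d) ≡ (a + c) + (b + d)
interchange = solve-∀

sumL-+ : (f g : A → ℕ) (xs : List A) → sumL (λ x → f x + g x) xs ≡ sumL f xs + sumL g xs
sumL-+ f g []       = refl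
sumL-+ f g (x ∷ xs) rewrite sumL-+ f g xs = interchange (f x) (g x) (sumL f xs) (sumL g xs)

sumL-*ˡ : (c : ℕ) (f : A → ℕ) (xs : List A) → sumL (λ x → c * f x) xs ≡ c * sumL f xs
sumL-*ˡ c f []       = sym (*-zeroʳ c)
sumL-*ˡ c f (x ∷ xs) rewrite sumL-*ˡ c f xs = sym (*-distribˡ-+ c (f x) _)

sumL-exchange : (f : A → B → ℕ) (xs : List A) (ys : List B) →
  sumL (λ x → sumL (f x) ys) xs ≡ sumL (λ y → sumL (λ x → f x y) xs) ys
sumL-exchange f []       ys = sym (sumL-0 ys)
sumL-exchange f (x ∷ xs) ys rewrite sumL-exchange f xs ys =
  sym (sumL-+ (f x) (λ y → sumL (λ x → f x y) xs) ys)

sumL-const : (c : ℕ) (xs : List A) → sumL (λ _ → c) xs ≡ length xs * c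
sumL-const c []       = refl
sumL-const c (x ∷ xs) = cong (c +_) (sumL-const c xs)

sumL-mono-≤ : {f g : A → ℕ} → (∀ x → f x ≤ g x) → ∀ xs → sumL f xs ≤ sumL g xs
sumL-mono-≤ le []       = z≤n
sumL-mono-≤ le (x ∷ xs) = +-mono-≤ (le x) (sumL-mono-≤ le xs)

sumL-mono-< : {f g : A → ℕ} {xs : List A} {x : A} → (∀ x → f x ≤ g x) →
  x ∈ xs → f x < g x → sumL f xs < sumL g xs
sumL-mono-< {xs = _ ∷ xs} le (here refl) lt = +-mono-<-≤ lt (sumL-mono-≤ le xs)
sumL-mono-< {xs = y ∷ xs} le (there x∈) lt = +-mono-≤-< (le y) (sumL-mono-< le x∈ lt)

sumL-∈ : (f : A → ℕ) {xs : List A} {x : A} → x ∈ xs → f x ≤ sumL f xs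
sumL-∈ f (here refl)        = m≤m+n _ _
sumL-∈ f {y ∷ _} (there x∈) = ≤-trans (sumL-∈ f x∈) (m≤n+m _ (f y))

sumL-≡0 : (f : A → ℕ) {xs : List A} {x : A} → sumL f xs ≡ 0 → x ∈ xs → f x ≡ 0
sumL-≡0 f e x∈ = n≤0⇒n≡0 (subst (_ ≤_) e (sumL-∈ f x∈))

sumL-allFin-suc : ∀ k (f : Fin (suc k) → ℕ) →
  sumL f (allFin (suc k)) ≡ f zero + sumL (f ∘ suc) (allFin k)
sumL-allFin-suc k f = cong (f zero +_)
  (trans (cong (sumL f) (sym (List.map-tabulate (λ i → i) suc))) (sumL-map f suc (allFin k)))

module _ (_≟_ : DecidableEquality A) where

  ι : A → A → ℕ
  ι x y = ⟦ x ≟ y ⟧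

  ι-refl : ∀ x → ι x x ≡ 1
  ι-refl x = ⟦yes⟧ (x ≟ x) refl

  ι-≢ : ∀ {x y} → x ≢ y → ι x y ≡ 0
  ι-≢ {x} {y} = ⟦no⟧ (x ≟ y)

  ι-sym : ∀ x y → ι x y ≡ ι y x
  ι-sym x y = ⟦⟧-⇔ (x ≟ y) (y ≟ x) sym sym

  ι-* : ∀ (f : A → ℕ) x y → ι x y * f x ≡ ι x y * f y
  ι-* f x y with x ≟ y
  ... | yes refl = refl
  ... | no _     = refl

sumL-ι : ∀ {k} (s : Fin k) (f : Fin k → ℕ) → sumL (λ i → ι _≟_ i s * f i) (allFin k) ≡ f s
sumL-ι {suc k} s f = trans (sumL-allFin-suc k _) (lem s)
  where
  lem : ∀ s → ι _≟_ zero s * f zero + sumL (λ i → ι _≟_ (suc i) s * f (suc i)) (allFin k) ≡ f s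
  lem zero = trans (cong₂ _+_ (*-identityˡ (f zero))
    (trans (sumL-cong (λ i → cong (_* f (suc i)) (ι-≢ _≟_ {suc i} {zero} λ ())) (allFin k)) (sumL-0 (allFin k))))
    (+-identityʳ _)
  lem (suc s) = trans (cong₂ _+_ (cong (_* f zero) (ι-≢ _≟_ {zero} {suc s} λ ()))
    (sumL-cong (λ i → cong (_* f (suc i))
      (⟦⟧-⇔ (suc i ≟ suc s) (i ≟ s) Fin.suc-injective (cong suc))) (allFin k)))
    (sumL-ι s (f ∘ suc))

Pointwise-++⁻ : ∀ {R : A → B → Set} xs {ys zs} → Pointwise R (xs ++ ys) zs →
  ∃ λ us → ∃ λ vs → zs ≡ us ++ vs × Pointwise R xs us × Pointwise R ys vs
Pointwise-++⁻ []       rs = [] , _ , refl , [] , rs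
Pointwise-++⁻ (x ∷ xs) (r ∷ rs) with Pointwise-++⁻ xs rs
... | us , vs , refl , ps , qs = _ ∷ us , vs , refl , r ∷ ps , qs

-- Balanced orientations of multigraphs

module Orientation (_≟_ : DecidableEquality B) where

  outdeg indeg : B → List (B × B) → ℕ
  outdeg b = sumL (λ e → ι _≟_ (proj₁ e) b)
  indeg  b = sumL (λ e → ι _≟_ (proj₂ e) b)

  Flip : B × B → B × B → Set
  Flip e o = o ≡ e ⊎ o ≡ swap e

  -- A vertex of odd degree cannot have equal outdegree and indegree, so a difference of one is
  -- tolerated in either direction. The levelling of columns needs no more.
  Balanced : List (B × B) → Set
  Balanced os = ∀ b → (outdeg b os ≤ suc (indeg b os)) × (indeg b os ≤ suc (outdeg b os))

  Flip-sym : ∀ {e o} → Flip e o → Flip o e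
  Flip-sym (inj₁ refl) = inj₁ refl
  Flip-sym (inj₂ refl) = inj₂ refl

  Flip-trans : ∀ {e f o} → Flip e f → Flip f o → Flip e o
  Flip-trans (inj₁ refl) q           = q
  Flip-trans (inj₂ refl) (inj₁ refl) = inj₂ refl
  Flip-trans (inj₂ refl) (inj₂ refl) = inj₁ refl

  Orientable : List (B × B) → Set
  Orientable es = ∃ λ os → Pointwise Flip es os × Balanced os

  AvoidsVertex : B → B × B → Set
  AvoidsVertex v e = proj₁ e ≢ v × proj₂ e ≢ v

  splitAtVertex : ∀ v es →
    (∃ λ pre → ∃ λ f → ∃ λ post → ∃ λ w → es ≡ pre ++ f ∷ post × Flip (v , w) f)
    ⊎ All (AvoidsVertex v) es
  splitAtVertex v [] = inj₂ []
  splitAtVertex v (e@(x , y) ∷ es) with x ≟ v | y ≟ v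
  ... | yes refl | _        = inj₁ ([] , e , es , y , refl , inj₁ refl)
  ... | no _     | yes refl = inj₁ ([] , e , es , x , refl , inj₂ refl)
  ... | no x≢v   | no y≢v with splitAtVertex v es
  ...   | inj₁ (pre , f , post , w , refl , fl) = inj₁ (e ∷ pre , f , post , w , refl , fl)
  ...   | inj₂ av = inj₂ ((x≢v , y≢v) ∷ av)

  ≤suc-shift : ∀ {x y x' y'} z → x' ≡ z + x → y' ≡ z + y → x ≤ suc y → x' ≤ suc y'
  ≤suc-shift {x} {y} z refl refl le =
    ≤-trans (+-monoʳ-≤ z le) (≤-reflexive (+-suc z y))

  -- The two edges uv and vw are replaced by uw; an orientation of uw lifts to the path u v w.
  lift : ∀ u v w pre f post → Flip (v , w) f → Orientable ((u , w) ∷ pre ++ post) →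
    Orientable ((u , v) ∷ pre ++ f ∷ post)
  lift u v w pre f post fl (_ ∷ os , fo ∷ pw , bal) with Pointwise-++⁻ pre pw
  ... | os₁ , os₂ , refl , pw₁ , pw₂ = go fo
    where
    +-comm-middle : ∀ a b c → a + (b + c) ≡ b + (a + c)
    +-comm-middle = solve-∀
    -- `v` is once a tail and once a head on the path. The two orders of summation bring this
    -- contribution to the front; what remains is the degree sum of the orientation with the single
    -- edge uw.
    sums₁ : ∀ (φ : B × B → ℕ) p q → sumL φ (p ∷ os₁ ++ q ∷ os₂) ≡ φ q + (φ p + sumL φ (os₁ ++ os₂))
    sums₁ φ p q rewrite sumL-++ φ os₁ (q ∷ os₂) | sumL-++ φ os₁ os₂ =
      eq (φ p) (sumL φ os₁) (φ q) (sumL φ os₂)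
      where
      eq : ∀ a b c d → a + (b + (c + d)) ≡ c + (a + (b + d))
      eq = solve-∀
    sums₂ : ∀ (φ : B × B → ℕ) p q → sumL φ (p ∷ os₁ ++ q ∷ os₂) ≡ φ p + (φ q + sumL φ (os₁ ++ os₂))
    sums₂ φ p q = trans (sums₁ φ p q) (+-comm-middle (φ q) (φ p) _)
    go : Flip (u , w) _ → Orientable ((u , v) ∷ pre ++ f ∷ post)
    go (inj₁ refl) = (u , v) ∷ os₁ ++ (v , w) ∷ os₂ ,
      inj₁ refl ∷ Pointwise-++⁺ pw₁ (Flip-sym fl ∷ pw₂) ,
      λ b → let o = sums₁ (λ e → ι _≟_ (proj₁ e) b) (u , v) (v , w)
                i = sums₂ (λ e → ι _≟_ (proj₂ e) b) (u , v) (v , w)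
            in ≤suc-shift (ι _≟_ v b) o i (proj₁ (bal b)) , ≤suc-shift (ι _≟_ v b) i o (proj₂ (bal b))
    go (inj₂ refl) = (v , u) ∷ os₁ ++ (w , v) ∷ os₂ ,
      inj₂ refl ∷ Pointwise-++⁺ pw₁ (Flip-trans (Flip-sym fl) (inj₂ refl) ∷ pw₂) ,
      λ b → let o = sums₂ (λ e → ι _≟_ (proj₁ e) b) (v , u) (w , v)
                i = sums₁ (λ e → ι _≟_ (proj₂ e) b) (v , u) (w , v)
            in ≤suc-shift (ι _≟_ v b) o i (proj₁ (bal b)) , ≤suc-shift (ι _≟_ v b) i o (proj₂ (bal b))

  reverseHead : ∀ {u v es} → Orientable ((u , v) ∷ es) → Orientable ((v , u) ∷ es)
  reverseHead (os , fl ∷ pw , bal) = os , Flip-trans (inj₂ refl) fl ∷ pw , bal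

  avoid-Flip : ∀ {v es os} → All (AvoidsVertex v) es → Pointwise Flip es os →
    outdeg v os ≡ 0 × indeg v os ≡ 0
  avoid-Flip [] [] = refl , refl
  avoid-Flip {v} ((p , q) ∷ av) (inj₁ refl ∷ pw) with avoid-Flip av pw
  ... | o , i rewrite ι-≢ _≟_ p | ι-≢ _≟_ q = o , i
  avoid-Flip {v} ((p , q) ∷ av) (inj₂ refl ∷ pw) with avoid-Flip av pw
  ... | o , i rewrite ι-≢ _≟_ p | ι-≢ _≟_ q = o , i

  -- The edge forms a component of its own, so both ends have degree one and any direction is
  -- balanced up to one.
  isolate : ∀ {u v es} → u ≢ v → All (AvoidsVertex u) es → All (AvoidsVertex v) es →
    Orientable es → Orientable ((u , v) ∷ es)
  isolate {u} {v} u≢v au av (os , pw , bal) = (u , v) ∷ os , inj₁ refl ∷ pw , go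
    where
    go : Balanced ((u , v) ∷ os)
    go b with u ≟ b | v ≟ b
    ... | yes refl | yes refl = ⊥-elim (u≢v refl)
    ... | yes refl | no _ rewrite proj₁ (avoid-Flip au pw) | proj₂ (avoid-Flip au pw) = s≤s z≤n , z≤n
    ... | no _ | yes refl rewrite proj₁ (avoid-Flip av pw) | proj₂ (avoid-Flip av pw) = z≤n , s≤s z≤n
    ... | no _ | no _ = bal b

  loop : ∀ {u es} → Orientable es → Orientable ((u , u) ∷ es)
  loop {u} (os , pw , bal) = (u , u) ∷ os , inj₁ refl ∷ pw ,
    λ b → ≤suc-shift (ι _≟_ u b) refl refl (proj₁ (bal b)) , ≤suc-shift (ι _≟_ u b) refl refl (proj₂ (bal b))

  shorter : ∀ {N} (e f : B × B) pre post → length (pre ++ f ∷ post) ≤ N → length (e ∷ pre ++ post) ≤ N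
  shorter {N} e f pre post = subst (_≤ N)
    (trans (List.length-++ pre) (trans (+-suc (length pre) (length post)) (cong suc (sym (List.length-++ pre)))))

  -- Induction on the number of edges, bounded by `N` because the shortened list is no sublist of
  -- the given one. A loop changes both degrees alike; an edge uv that meets another edge at `v` or
  -- at `u` is merged with it; otherwise uv is isolated.
  orientWithin : ∀ N es → length es ≤ N → Orientable es
  orientWithin N [] _ = [] , [] , λ _ → z≤n , z≤n
  orientWithin (suc N) ((u , v) ∷ es) (s≤s le) with u ≟ v
  ... | yes refl = loop (orientWithin N es le)
  ... | no u≢v with splitAtVertex v es
  ...   | inj₁ (pre , f , post , w , refl , fl) =
          lift u v w pre f post fl (orientWithin N _ (shorter (u , w) f pre post le))
  ...   | inj₂ av with splitAtVertex u es
  ...     | inj₁ (pre , f , post , w , refl , fl) =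
            reverseHead (lift v u w pre f post fl (orientWithin N _ (shorter (v , w) f pre post le)))
  ...     | inj₂ au = isolate u≢v au av (orientWithin N es le)

  orient : ∀ es → Orientable es
  orient es = orientWithin (length es) es ≤-refl

-- Balanced systems of representatives

∸-sum : ∀ {x y c} → c ≤ x → c ≤ y → (x ∸ c) + (y ∸ c) + (c + c) ≡ x + y
∸-sum {x} {y} {c} c≤x c≤y =
  trans (interchange (x ∸ c) (y ∸ c) c c) (cong₂ _+_ (m∸n+n≡m c≤x) (m∸n+n≡m c≤y))

x≤x∸c+c : ∀ x c → x ≤ x ∸ c + c
x≤x∸c+c x c = subst (x ≤_) (+-comm c _) (m≤n+m∸n x c)

-- Two numbers that differ by at most one cannot lie strictly on opposite sides of `c`. Hence both
-- truncated differences vanish or both are exact.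
leveled : ∀ {x y c} → x ≤ suc y → y ≤ suc x → (x ∸ c ≡ 0 × y ∸ c ≡ 0) ⊎ (c ≤ x × c ≤ y)
leveled {x} {y} {c} x≤ y≤ with x ≤? c | y ≤? c
... | yes p | yes q = inj₁ (m≤n⇒m∸n≡0 p , m≤n⇒m∸n≡0 q)
... | yes p | no ¬q = inj₂ (≤-pred (≤-trans (≰⇒> ¬q) y≤) , <⇒≤ (≰⇒> ¬q))
... | no ¬p | yes q = inj₂ (<⇒≤ (≰⇒> ¬p) , ≤-pred (≤-trans (≰⇒> ¬p) x≤))
... | no ¬p | no ¬q = inj₂ (<⇒≤ (≰⇒> ¬p) , <⇒≤ (≰⇒> ¬q))

-- Convexity of `t ↦ t ∸ c`: replacing two numbers by nearly equal ones of the same sum does not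
-- increase the total excess over `c`.
leveling-≤ : ∀ {x y x' y' c} → x' + y' ≡ x + y → x' ≤ suc y' → y' ≤ suc x' →
  (x' ∸ c) + (y' ∸ c) ≤ (x ∸ c) + (y ∸ c)
leveling-≤ {x} {y} {c = c} e x'≤ y'≤ with leveled {c = c} x'≤ y'≤
... | inj₁ (p , q) rewrite p | q = z≤n
... | inj₂ (p , q) = +-cancelʳ-≤ (c + c) _ _
  (≤-trans (≤-reflexive (trans (∸-sum p q) e))
  (≤-trans (+-mono-≤ (x≤x∸c+c x c) (x≤x∸c+c y c)) (≤-reflexive (interchange (x ∸ c) c (y ∸ c) c))))

-- The gain is strict since the deficit of `y` absorbs part of the surplus of `x`.
leveling-< : ∀ {x y x' y' c} → x' + y' ≡ x + y → x' ≤ suc y' → y' ≤ suc x' → c < x → y < c →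
  (x' ∸ c) + (y' ∸ c) < (x ∸ c) + (y ∸ c)
leveling-< {x} {y} {c = c} e x'≤ y'≤ c<x y<c with leveled {c = c} x'≤ y'≤
... | inj₁ (p , q) rewrite p | q = ≤-trans (m<n⇒0<n∸m c<x) (m≤m+n _ _)
... | inj₂ (p , q) = +-cancelʳ-< (c + c) _ _
  (≤-<-trans (≤-reflexive (trans (∸-sum p q) e))
  (<-≤-trans (+-mono-≤-< (x≤x∸c+c x c) (<-≤-trans y<c (m≤n+m c (y ∸ c))))
    (≤-reflexive (interchange (x ∸ c) c (y ∸ c) c))))

-- The old values at the two points are added on one side and the new ones on the other, which
-- avoids subtraction; indicators turn the point values into sums over all indices.
sumL-twoPoints : ∀ {k} {s s' : Fin k} {f f' : Fin k → ℕ} → s ≢ s' →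
  (∀ i → i ≢ s → i ≢ s' → f' i ≡ f i) →
  sumL f' (allFin k) + (f s + f s') ≡ sumL f (allFin k) + (f' s + f' s')
sumL-twoPoints {k} {s} {s'} {f} {f'} s≢s' off = begin
  sumL f' L + (f s + f s')
    ≡⟨ cong (sumL f' L +_) (cong₂ _+_ (sumL-ι s f) (sumL-ι s' f)) ⟨
  sumL f' L + (sumL (λ i → ι _≟_ i s * f i) L + sumL (λ i → ι _≟_ i s' * f i) L)
    ≡⟨ total f' f ⟨
  sumL (λ i → f' i + (ι _≟_ i s * f i + ι _≟_ i s' * f i)) L
    ≡⟨ sumL-cong pointwise L ⟩
  sumL (λ i → f i + (ι _≟_ i s * f' i + ι _≟_ i s' * f' i)) L
    ≡⟨ total f f' ⟩
  sumL f L + (sumL (λ i → ι _≟_ i s * f' i) L + sumL (λ i → ι _≟_ i s' * f' i) L)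
    ≡⟨ cong (sumL f L +_) (cong₂ _+_ (sumL-ι s f') (sumL-ι s' f')) ⟩
  sumL f L + (f' s + f' s') ∎
  where
  open ≡-Reasoning
  L = allFin k
  total : ∀ (p q : Fin k → ℕ) → sumL (λ i → p i + (ι _≟_ i s * q i + ι _≟_ i s' * q i)) L ≡
    sumL p L + (sumL (λ i → ι _≟_ i s * q i) L + sumL (λ i → ι _≟_ i s' * q i) L)
  total p q = trans (sumL-+ p _ L) (cong (sumL p L +_) (sumL-+ (λ i → ι _≟_ i s * q i) _ L))
  pointwise : ∀ i → f' i + (ι _≟_ i s * f i + ι _≟_ i s' * f i) ≡ f i + (ι _≟_ i s * f' i + ι _≟_ i s' * f' i)
  pointwise i with i ≟ s | i ≟ s'
  ... | yes refl | yes refl = contradiction refl s≢s'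
  ... | yes refl | no _     = eq (f' i) (f i)
    where
    eq : ∀ a b → a + (b + 0 + 0) ≡ b + (a + 0 + 0)
    eq = solve-∀
  ... | no _     | yes refl = eq (f' i) (f i)
    where
    eq : ∀ a b → a + (b + 0) ≡ b + (a + 0)
    eq = solve-∀
  ... | no p     | no q     = cong (_+ 0) (off i p q)

sumL-allFin-const : ∀ k c → sumL (λ _ → c) (allFin k) ≡ k * c
sumL-allFin-const k c = trans (sumL-const c (allFin k)) (cong (_* c) (List.length-tabulate {n = k} (λ i → i)))

below-average : ∀ {k c} {f : Fin k → ℕ} {s} → sumL f (allFin k) ≡ k * c → c < f s → ∃ λ s' → f s' < c
below-average {k} {c} {f} {s} e c<fs with Fin.any? (λ i → f i <? c)
... | yes found = found
... | no ¬found = contradiction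
  (subst₂ _<_ (sumL-allFin-const k c) e
    (sumL-mono-< (λ i → ≮⇒≥ (λ lt → ¬found (i , lt))) (∈-allFin s) c<fs))
  (<-irrefl refl)

all-average : ∀ {k c} {f : Fin k → ℕ} → sumL f (allFin k) ≡ k * c → (∀ i → f i ≤ c) → ∀ i → f i ≡ c
all-average {k} {c} {f} e le i with m≤n⇒m<n∨m≡n (le i)
... | inj₂ eq = eq
... | inj₁ lt = contradiction
  (subst₂ _<_ e (sumL-allFin-const k c) (sumL-mono-< le (∈-allFin i) lt)) (<-irrefl refl)

module Representatives (_≟B_ : DecidableEquality B) (Bs : List B) (complete : ∀ b → b ∈ Bs)
  (g : ℕ) (c : B → ℕ) where

  open Orientation _≟B_

  Row : Set
  Row = Fin g → B

  columnCount : List Row → Fin g → B → ℕ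
  columnCount R s b = sumL (λ r → ι _≟B_ (r s) b) R

  -- Weaker than being a permutation. Multiplicities are controlled by the column counts, and of a
  -- single row it only has to be known that its new entries come from the old row.
  Rearranged : Row → Row → Set
  Rearranged r r' = ∀ i → ∃ λ i' → r' i ≡ r i'

  -- The termination measure: rebalancing an overfull with an underfull column decreases it.
  excess : List Row → ℕ
  excess R = sumL (λ b → sumL (λ s → columnCount R s b ∸ c b) (allFin g)) Bs

  module _ {s s' : Fin g} (s≢s' : s ≢ s') where

    transposed : Row → Row
    transposed r i with i ≟ s | i ≟ s'
    ... | yes _ | _     = r s'
    ... | no _  | yes _ = r s
    ... | no _  | no _  = r i

    transposed-s : ∀ r → transposed r s ≡ r s'
    transposed-s r with s ≟ s
    ... | yes _ = refl
    ... | no ¬p = contradiction refl ¬p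

    transposed-s' : ∀ r → transposed r s' ≡ r s
    transposed-s' r with s' ≟ s | s' ≟ s'
    ... | yes p | _     = contradiction (sym p) s≢s'
    ... | no _  | yes _ = refl
    ... | no _  | no ¬p = contradiction refl ¬p

    transposed-other : ∀ r i → i ≢ s → i ≢ s' → transposed r i ≡ r i
    transposed-other r i p q with i ≟ s | i ≟ s'
    ... | yes e | _     = contradiction e p
    ... | no _  | yes e = contradiction e q
    ... | no _  | no _  = refl

    transposed-rearranged : ∀ r → Rearranged r (transposed r)
    transposed-rearranged r i with i ≟ s | i ≟ s'
    ... | yes _ | _     = s' , refl
    ... | no _  | yes _ = s , refl
    ... | no _  | no _  = i , refl

    -- The row as a directed edge from its entry in column `s` to its entry in column `s'`.
    -- Outdegrees then are the counts in column `s`, indegrees those in column `s'`, and reversing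
    -- an edge means transposing the row.
    ends : Row → B × B
    ends r = r s , r s'

    record SameElsewhere (R R' : List Row) : Set where
      field
        rearranged : Pointwise Rearranged R R'
        pairSum    : ∀ b → columnCount R' s b + columnCount R' s' b ≡ columnCount R s b + columnCount R s' b
        elsewhere  : ∀ i → i ≢ s → i ≢ s' → ∀ b → columnCount R' i b ≡ columnCount R i b
    open SameElsewhere

    realize : ∀ R {os} → Pointwise Flip (map ends R) os →
      ∃ λ R' → map ends R' ≡ os × SameElsewhere R R'
    realize [] [] = [] , refl , record { rearranged = [] ; pairSum = λ _ → refl ; elsewhere = λ _ _ _ _ → refl }
    realize (r ∷ R) (fl ∷ pw) with realize R pw
    realize (r ∷ R) (inj₁ refl ∷ pw) | R' , refl , same = r ∷ R' , refl , record
      { rearranged = (λ i → i , refl) ∷ rearranged same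
      ; pairSum    = λ b → step (ι _≟B_ (r s) b) (ι _≟B_ (r s') b) _ _ _ _ (pairSum same b)
      ; elsewhere  = λ i p q b → cong (ι _≟B_ (r i) b +_) (elsewhere same i p q b) }
      where
      step : ∀ a d x y z w → x + y ≡ z + w → (a + x) + (d + y) ≡ (a + z) + (d + w)
      step a d x y z w e = trans (interchange a x d y) (trans (cong (a + d +_) e) (interchange a d z w))
    realize (r ∷ R) (inj₂ refl ∷ pw) | R' , refl , same = transposed r ∷ R' ,
      cong₂ _∷_ (cong₂ _,_ (transposed-s r) (transposed-s' r)) refl , record
      { rearranged = transposed-rearranged r ∷ rearranged same
      ; pairSum    = λ b → trans
          (cong₂ (λ x y → (ι _≟B_ x b + columnCount R' s b) + (ι _≟B_ y b + columnCount R' s' b))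
            (transposed-s r) (transposed-s' r))
          (step (ι _≟B_ (r s') b) (ι _≟B_ (r s) b) _ _ _ _ (pairSum same b))
      ; elsewhere  = λ i p q b → cong₂ _+_ (cong (λ x → ι _≟B_ x b) (transposed-other r i p q))
          (elsewhere same i p q b) }
      where
      step : ∀ a d x y z w → x + y ≡ z + w → (a + x) + (d + y) ≡ (d + z) + (a + w)
      step a d x y z w e = trans (interchange a x d y)
        (trans (cong₂ _+_ (+-comm a d) e) (interchange d a z w))

    rebalance : ∀ R → ∃ λ R' → SameElsewhere R R' ×
      (∀ b → (columnCount R' s b ≤ suc (columnCount R' s' b)) × (columnCount R' s' b ≤ suc (columnCount R' s b)))
    rebalance R with orient (map ends R)
    ... | os , pw , bal with realize R pw
    ...   | R' , refl , same = R' , same , λ b →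
            subst₂ (λ x y → (x ≤ suc y) × (y ≤ suc x)) (sumL-map _ ends R') (sumL-map _ ends R') (bal b)

    rebalance-sum : ∀ {R R'} → SameElsewhere R R' → ∀ b →
      sumL (λ i → columnCount R' i b) (allFin g) ≡ sumL (λ i → columnCount R i b) (allFin g)
    rebalance-sum {R} {R'} same b = +-cancelʳ-≡ _ _ _
      (trans (sumL-twoPoints {f = λ i → columnCount R i b} {f' = λ i → columnCount R' i b} s≢s'
               (λ i p q → elsewhere same i p q b))
             (cong (sumL (λ i → columnCount R i b) (allFin g) +_) (pairSum same b)))

    overload : List Row → B → ℕ
    overload R b = sumL (λ i → columnCount R i b ∸ c b) (allFin g)

    overload-change : ∀ {R R'} → SameElsewhere R R' → ∀ b →
      overload R' b + ((columnCount R s b ∸ c b) + (columnCount R s' b ∸ c b)) ≡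
      overload R b + ((columnCount R' s b ∸ c b) + (columnCount R' s' b ∸ c b))
    overload-change {R} {R'} same b =
      sumL-twoPoints {f = λ i → columnCount R i b ∸ c b} {f' = λ i → columnCount R' i b ∸ c b} s≢s'
        (λ i p q → cong (_∸ c b) (elsewhere same i p q b))

    -- After rebalancing, every symbol has nearly equal counts in the two columns with the same sum.
    -- By convexity no symbol gains excess, and `b`, overfull in one column and underfull in the
    -- other, loses some. The other columns are unchanged.
    rebalance-excess : ∀ R b → c b < columnCount R s b → columnCount R s' b < c b →
      ∃ λ R' → SameElsewhere R R' × excess R' < excess R
    rebalance-excess R b over under with rebalance R
    ... | R' , same , bal = R' , same , sumL-mono-<
      (λ b' → cancel-≤ (overload-change same b') (leveling-≤ {columnCount R s b'} {columnCount R s' b'} {c = c b'} (pairSum same b') (proj₁ (bal b')) (proj₂ (bal b'))))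
      (complete b)
      (cancel-< (overload-change same b)
        (leveling-< {columnCount R s b} {columnCount R s' b} (pairSum same b) (proj₁ (bal b)) (proj₂ (bal b)) over under))
      where
      cancel-≤ : ∀ {p q x y} → p + x ≡ q + y → y ≤ x → p ≤ q
      cancel-≤ {p} {q} {x} e y≤x = +-cancelʳ-≤ x p q (≤-trans (≤-reflexive e) (+-monoʳ-≤ q y≤x))
      cancel-< : ∀ {p q x y} → p + x ≡ q + y → y < x → p < q
      cancel-< {p} {q} {x} e y<x = +-cancelʳ-< x p q (≤-<-trans (≤-reflexive e) (+-monoʳ-< q y<x))

  Regular : List Row → Set
  Regular R = ∀ b → sumL (λ s → columnCount R s b) (allFin g) ≡ g * c b

  Rearranged-trans : ∀ {R R' R''} → Pointwise Rearranged R R' → Pointwise Rearranged R' R'' →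
    Pointwise Rearranged R R''
  Rearranged-trans []       []       = []
  Rearranged-trans {r ∷ _} (p ∷ ps) (q ∷ qs) =
    (λ i → let j , e = q i ; l , e' = p j in l , trans e e') ∷ Rearranged-trans ps qs

  Rearranged-refl : ∀ R → Pointwise Rearranged R R
  Rearranged-refl []      = []
  Rearranged-refl (r ∷ R) = (λ i → i , refl) ∷ Rearranged-refl R

  -- The counts of `b` have average `c b`, so an overfull column comes with an underfull one and the
  -- two can be rebalanced. Without overfull columns the average forces equality everywhere. `N`
  -- bounds the number of rounds.
  levelWithin : ∀ N R → excess R ≤ N → Regular R →
    ∃ λ R' → Pointwise Rearranged R R' × (∀ s b → columnCount R' s b ≡ c b)
  levelWithin N R le reg with any? (λ b → Fin.any? (λ s → c b <? columnCount R s b)) Bs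
  ... | no ¬over = R , Rearranged-refl R , λ s b →
    all-average (reg b) (λ i → ≮⇒≥ (λ lt → ¬over (lose (complete b) (i , lt)))) s
  ... | yes over with find over
  ...   | b , _ , s , c< with below-average {s = s} (reg b) c<
  ...     | s' , <c with rebalance-excess {s} {s'} (λ { refl → <-asym c< <c }) R b c< <c
  levelWithin zero    R le reg | yes over | b , _ , s , c< | s' , <c | R' , same , ex =
    contradiction (<-≤-trans ex le) λ ()
  levelWithin (suc N) R le reg | yes over | b , _ , s , c< | s' , <c | R' , same , ex
    with levelWithin N R' (≤-pred (<-≤-trans ex le)) (λ b' → trans (rebalance-sum _ same b') (reg b'))
  ... | R'' , re , lev = R'' , Rearranged-trans (SameElsewhere.rearranged same) re , lev

  Transversal : List Row → List B → Set
  Transversal = Pointwise (λ r x → ∃ λ i → x ≡ r i)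

  column : ∀ s {R R'} → Pointwise Rearranged R R' → Transversal R (map (λ r → r s) R')
  column s []       = []
  column s (p ∷ ps) = p s ∷ column s ps

  -- Once all columns have the same content, any one of them is the required system; the given index
  -- names the column.
  represent : Fin g → ∀ R →
    (∀ b → sumL (λ r → sumL (λ s → ι _≟B_ (r s) b) (allFin g)) R ≡ g * c b) →
    ∃ λ picks → Transversal R picks × (∀ b → sumL (λ x → ι _≟B_ x b) picks ≡ c b)
  represent s R reg
    with levelWithin _ R ≤-refl (λ b → trans (sumL-exchange (λ i r → ι _≟B_ (r i) b) (allFin g) R) (reg b))
  ... | R' , re , lev = map (λ r → r s) R' , column s re ,
          λ b → trans (sumL-map _ (λ r → r s) R') (lev s b)

-- Reversal and enumeration of lists

sumL-reverse : (f : A → ℕ) (xs : List A) → sumL f (reverse xs) ≡ sumL f xs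
sumL-reverse f []       = refl
sumL-reverse f (x ∷ xs) rewrite List.unfold-reverse x xs | sumL-++ f (reverse xs) [ x ] | sumL-reverse f xs =
  trans (+-comm (sumL f xs) _) (cong (_+ sumL f xs) (+-identityʳ (f x)))

-- Equality of sums for every `f` expresses equality of multisets; no permutations are handled
-- explicitly. The edges and the vertices of walks are compared in the same way below.
record Enumeration (g : ℕ) (xs : List A) : Set where
  field
    entry   : Fin g → A
    sum-all : ∀ f → sumL (f ∘ entry) (allFin g) ≡ sumL f xs
    without  : Fin g → List A
    sum-one : ∀ i f → sumL f xs ≡ f (entry i) + sumL f (without i)

enumerate : (xs : List A) → Enumeration (length xs) xs
enumerate [] = record { entry = λ () ; sum-all = λ _ → refl ; without = λ () ; sum-one = λ () }
enumerate (x ∷ xs) = record { entry = entry' ; sum-all = sum-all' ; without = without' ; sum-one = sum-one' }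
  where
  rec = enumerate xs
  entry' : Fin (suc (length xs)) → _
  entry' zero    = x
  entry' (suc i) = Enumeration.entry rec i
  without' : Fin (suc (length xs)) → List _
  without' zero    = xs
  without' (suc i) = x ∷ Enumeration.without rec i
  sum-all' : ∀ f → sumL (f ∘ entry') (allFin (suc (length xs))) ≡ f x + sumL f xs
  sum-all' f = trans (sumL-allFin-suc (length xs) (f ∘ entry')) (cong (f x +_) (Enumeration.sum-all rec f))
  sum-one' : ∀ i f → f x + sumL f xs ≡ f (entry' i) + sumL f (without' i)
  sum-one' zero    f = refl
  sum-one' (suc i) f = trans (cong (f x +_) (Enumeration.sum-one rec i f)) (eq (f x) (f (Enumeration.entry rec i)) _)
    where
    eq : ∀ a b c → a + (b + c) ≡ b + (a + c)
    eq = solve-∀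

-- Closed walks

module Walks {V : Set} (_≟V_ : DecidableEquality V) where

  -- The function `φ` is a test function on edges: an identity that holds for all symmetric `φ` is
  -- an identity between multisets of undirected edges.
  pathSum : (V → V → ℕ) → V → List V → V → ℕ
  pathSum φ x []       y = φ x y
  pathSum φ x (z ∷ zs) y = φ x z + pathSum φ z zs y

  walkSum : (V → V → ℕ) → List V → ℕ
  walkSum φ []       = 0
  walkSum φ (x ∷ xs) = pathSum φ x xs x

  Symmetric : (V → V → ℕ) → Set
  Symmetric φ = ∀ x y → φ x y ≡ φ y x

  -- Tests whether a step joins `u` and `v` in either direction. For `u = v` a loop counts twice, so
  -- a vanishing sum of `link u u` certifies that there is no loop at `u`.
  link : V → V → V → V → ℕ
  link u v x y = ι _≟V_ x u * ι _≟V_ y v + ι _≟V_ x v * ι _≟V_ y u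

  link-sym : ∀ u v → Symmetric (link u v)
  link-sym u v x y = eq (ι _≟V_ x u) (ι _≟V_ y v) (ι _≟V_ x v) (ι _≟V_ y u)
    where
    eq : ∀ a b c d → a * b + c * d ≡ d * c + b * a
    eq = solve-∀

  link-loop : ∀ x → link x x x x ≡ 2
  link-loop x rewrite ι-refl _≟V_ x = refl

  pathSum-++ : ∀ φ x xs y ys z → pathSum φ x (xs ++ y ∷ ys) z ≡ pathSum φ x xs y + pathSum φ y ys z
  pathSum-++ φ x []       y ys z = refl
  pathSum-++ φ x (w ∷ xs) y ys z rewrite pathSum-++ φ w xs y ys z = sym (+-assoc (φ x w) _ _)

  pathSum-reverse : ∀ {φ} → Symmetric φ → ∀ x xs y → pathSum φ x (reverse xs) y ≡ pathSum φ y xs x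
  pathSum-reverse s x []       y = s x y
  pathSum-reverse {φ} s x (z ∷ xs) y
    rewrite List.unfold-reverse z xs | pathSum-++ φ x (reverse xs) z [] y | pathSum-reverse s x xs z | s z y =
    +-comm _ (φ y z)

  walkSum-rotate : ∀ φ xs y ys → walkSum φ (xs ++ y ∷ ys) ≡ pathSum φ y (ys ++ xs) y
  walkSum-rotate φ []       y ys = cong (λ zs → pathSum φ y zs y) (sym (List.++-identityʳ ys))
  walkSum-rotate φ (x ∷ xs) y ys = begin
    pathSum φ x (xs ++ y ∷ ys) x              ≡⟨ pathSum-++ φ x xs y ys x ⟩
    pathSum φ x xs y + pathSum φ y ys x       ≡⟨ +-comm (pathSum φ x xs y) _ ⟩
    pathSum φ y ys x + pathSum φ x xs y       ≡⟨ pathSum-++ φ y ys x xs y ⟨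
    pathSum φ y (ys ++ x ∷ xs) y              ∎
    where open ≡-Reasoning

  final : V → List V → V
  final x []       = x
  final x (y ∷ ys) = final y ys

  -- Changing the target of a path affects only its last edge, which starts at the final inner
  -- vertex.
  pathSum-redirect : ∀ φ x xs y z → pathSum φ x xs y + φ (final x xs) z ≡ pathSum φ x xs z + φ (final x xs) y
  pathSum-redirect φ x []       y z = +-comm (φ x y) _
  pathSum-redirect φ x (w ∷ xs) y z =
    trans (+-assoc (φ x w) _ _) (trans (cong (φ x w +_) (pathSum-redirect φ w xs y z)) (sym (+-assoc (φ x w) _ _)))

  -- The excursion (h , hs) stands for the nonempty vertex sequence h ∷ hs between two visits of α.
  Excursion : Set
  Excursion = V × List V

  module _ (α : V) where

    excursionSum : (V → V → ℕ) → Excursion → ℕ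
    excursionSum φ (h , hs) = φ α h + pathSum φ h hs α

    visitSum : (V → ℕ) → Excursion → ℕ
    visitSum χ (h , hs) = χ α + (χ h + sumL χ hs)

    -- The path from `y` through `xs` to `α`, cut at its visits to `α`. The first segment starts at
    -- `y`, each later one at `α`.
    record Segments (y : V) (xs : List V) : Set where
      field
        initial  : List V
        others   : List (List V)
        path-eq  : ∀ φ → pathSum φ y xs α ≡ pathSum φ y initial α + sumL (λ s → pathSum φ α s α) others
        vertices : ∀ χ → sumL χ xs ≡ sumL χ initial + sumL (λ s → χ α + sumL χ s) others
        avoids   : All (All (_≢ α)) (initial ∷ others)

    segments : ∀ y xs → Segments y xs
    segments y [] = record { initial = [] ; others = [] ; path-eq = λ φ → sym (+-identityʳ _)
      ; vertices = λ _ → refl ; avoids = [] ∷ [] }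
    segments y (x ∷ xs) with x ≟V α
    ... | yes refl = let open Segments (segments x xs) in record
      { initial = [] ; others = initial ∷ others
      ; path-eq = λ φ → cong (φ y x +_) (path-eq φ)
      ; vertices = λ χ → trans (cong (χ x +_) (vertices χ)) (sym (+-assoc (χ x) _ _))
      ; avoids = [] ∷ avoids }
    ... | no x≢α with segments x xs
    ...   | record { initial = i ; others = o ; path-eq = p ; vertices = v ; avoids = a ∷ as } = record
      { initial = x ∷ i ; others = o
      ; path-eq = λ φ → trans (cong (φ y x +_) (p φ)) (sym (+-assoc (φ y x) _ _))
      ; vertices = λ χ → trans (cong (χ x +_) (v χ)) (sym (+-assoc (χ x) _ _))
      ; avoids = (x≢α ∷ a) ∷ as }

    record Excursions (l : List V) : Set where
      field
        list     : List Excursion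
        walk-eq  : ∀ φ → walkSum φ l ≡ sumL (excursionSum φ) list
        vertices : ∀ χ → sumL χ l ≡ sumL (visitSum χ) list
        avoids   : All (λ e → All (_≢ α) (proj₁ e ∷ proj₂ e)) list

    -- An empty segment would be a step from `α` to itself, that is, a loop, which `link α α` counts
    -- as 2.
    nonempty : ∀ segs → All (All (_≢ α)) segs → sumL (λ s → pathSum (link α α) α s α) segs ≡ 0 →
      ∃ λ (es : List Excursion) → segs ≡ map (uncurry _∷_) es ×
        All (λ e → All (_≢ α) (proj₁ e ∷ proj₂ e)) es
    nonempty [] [] _ = [] , refl , []
    nonempty ([] ∷ segs) _ e = contradiction (trans (sym (link-loop α)) (m+n≡0⇒m≡0 _ e)) λ ()
    nonempty ((h ∷ hs) ∷ segs) (a ∷ as) e with nonempty segs as (m+n≡0⇒n≡0 (pathSum (link α α) α (h ∷ hs) α) e)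
    ... | es , refl , as' = (h , hs) ∷ es , refl , a ∷ as'

    splitAtVisit : ∀ l → 1 ≤ sumL (λ x → ι _≟V_ x α) l → ∃ λ xs → ∃ λ ys → l ≡ xs ++ α ∷ ys
    splitAtVisit (x ∷ l) le with x ≟V α
    ... | yes refl = [] , l , refl
    ... | no _ with splitAtVisit l le
    ...   | xs , ys , refl = x ∷ xs , ys , refl

    -- The walk is rotated to start at a visit of `α`. Then the initial segment starts at `α` like
    -- the others, and absence of loops makes all of them proper excursions.
    excursions : ∀ l → 1 ≤ sumL (λ x → ι _≟V_ x α) l → walkSum (link α α) l ≡ 0 → Excursions l
    excursions l visits loopless with splitAtVisit l visits
    ... | xs , ys , refl with segments α (ys ++ xs)
    ...   | record { initial = i ; others = o ; path-eq = p ; vertices = v ; avoids = a }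
          with nonempty (i ∷ o) a (trans (sym (trans (walkSum-rotate _ xs α ys) (p _))) loopless)
    ...     | es , e , as = record
      { list = es
      ; walk-eq = λ φ → trans (trans (walkSum-rotate φ xs α ys) (p φ))
          (trans (cong (sumL (λ s → pathSum φ α s α)) e) (sumL-map _ _ es))
      ; vertices = λ χ → trans (trans (rotated χ) (cong (χ α +_) (v χ)))
          (trans (sym (+-assoc (χ α) (sumL χ i) _)) (trans (cong (sumL (λ s → χ α + sumL χ s)) e) (sumL-map _ _ es)))
      ; avoids = as }
      where
      rotated : ∀ χ → sumL χ (xs ++ α ∷ ys) ≡ χ α + sumL χ (ys ++ xs)
      rotated χ rewrite sumL-++ χ xs (α ∷ ys) | sumL-++ χ ys xs = eq (sumL χ xs) (χ α) (sumL χ ys)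
        where
        eq : ∀ a b c → a + (b + c) ≡ b + (c + a)
        eq = solve-∀

    length-excursions : ∀ {l} (ex : Excursions l) →
      length (Excursions.list ex) ≡ sumL (λ x → ι _≟V_ x α) l
    length-excursions ex = sym (trans (vertices (λ x → ι _≟V_ x α)) (go avoids))
      where
      open Excursions ex
      zeros : ∀ {xs} → All (_≢ α) xs → sumL (λ x → ι _≟V_ x α) xs ≡ 0
      zeros []       = refl
      zeros (p ∷ ps) rewrite ι-≢ _≟V_ p = zeros ps
      go : ∀ {es} → All (λ e → All (_≢ α) (proj₁ e ∷ proj₂ e)) es →
        sumL (visitSum (λ x → ι _≟V_ x α)) es ≡ length es
      go []       = refl
      go (p ∷ ps) rewrite ι-refl _≟V_ α | zeros p = cong suc (go ps)

    -- Of the steps from `h` back to `α` only the last one touches `α`.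
    pathSum-avoiding : ∀ v h hs → All (_≢ α) (h ∷ hs) → pathSum (link α v) h hs α ≡ ι _≟V_ (final h hs) v
    pathSum-avoiding v h [] (p ∷ []) rewrite ι-≢ _≟V_ p | ι-refl _≟V_ α = *-identityʳ _
    pathSum-avoiding v h (x ∷ hs) (p ∷ q ∷ ps) rewrite ι-≢ _≟V_ p | ι-≢ _≟V_ q | *-zeroʳ (ι _≟V_ h v) =
      pathSum-avoiding v x hs (q ∷ ps)

    excursionSum-link : ∀ v h hs → All (_≢ α) (h ∷ hs) →
      excursionSum (link α v) (h , hs) ≡ ι _≟V_ h v + ι _≟V_ (final h hs) v
    excursionSum-link v h hs (p ∷ ps)
      rewrite pathSum-avoiding v h hs (p ∷ ps) | ι-refl _≟V_ α | ι-≢ _≟V_ p | *-zeroʳ (ι _≟V_ α v)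
            | +-identityʳ (ι _≟V_ h v) = cong (_+ ι _≟V_ (final h hs) v) (+-identityʳ (ι _≟V_ h v))

    EndOf : Excursion → V → Set
    EndOf (h , hs) x = x ≡ h ⊎ x ≡ final h hs

    -- The excursion is traversed so that it leaves its inner part at `x`. Thus going to `y` instead
    -- of `α` at the end exchanges the edge from `α` to `x` for the one from `y` to `x`; `φ α x` is
    -- added rather than subtracted.
    record Turned (e : Excursion) (x : V) : Set where
      field
        sequence : List V
        path-eq  : ∀ {φ} → Symmetric φ → ∀ y → pathSum φ α sequence y + φ α x ≡ excursionSum φ e + φ y x
        vertices : ∀ χ → sumL χ sequence ≡ χ (proj₁ e) + sumL χ (proj₂ e)

    turn : ∀ e x → EndOf e x → Turned e x
    turn (h , hs) x (inj₁ refl) = record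
      { sequence = reverse (h ∷ hs)
      ; path-eq = λ {φ} s y → trans (cong (_+ φ α h) (pathSum-reverse s α (h ∷ hs) y)) (eq (φ y h) _ (φ α h))
      ; vertices = λ χ → sumL-reverse χ (h ∷ hs) }
      where
      eq : ∀ a b c → a + b + c ≡ c + b + a
      eq = solve-∀
    turn (h , hs) x (inj₂ refl) = record
      { sequence = h ∷ hs
      ; path-eq = λ {φ} s y → trans (+-assoc (φ α h) _ _) (trans
          (cong (φ α h +_) (trans (cong (pathSum φ h hs y +_) (s α _))
            (trans (pathSum-redirect φ h hs y α) (cong (pathSum φ h hs α +_) (s _ y)))))
          (sym (+-assoc (φ α h) _ _)))
      ; vertices = λ χ → refl }

    unroll : List Excursion → List V
    unroll = concatMap (λ e → α ∷ proj₁ e ∷ proj₂ e)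

    pathSum-unroll : ∀ φ x xs es →
      pathSum φ x (xs ++ unroll es) α ≡ pathSum φ x xs α + sumL (excursionSum φ) es
    pathSum-unroll φ x xs [] = trans (cong (λ zs → pathSum φ x zs α) (List.++-identityʳ xs)) (sym (+-identityʳ _))
    pathSum-unroll φ x xs ((h , hs) ∷ es) =
      trans (pathSum-++ φ x xs α (h ∷ hs ++ unroll es) α)
        (cong (pathSum φ x xs α +_) (pathSum-unroll φ α (h ∷ hs) es))

    reroute : ∀ α' l e₁ x₁ e₂ x₂ es → EndOf e₁ x₁ → EndOf e₂ x₂ →
      (∀ φ → walkSum φ l ≡ excursionSum φ e₁ + (excursionSum φ e₂ + sumL (excursionSum φ) es)) →
      (∀ χ → sumL χ l ≡ visitSum χ e₁ + (visitSum χ e₂ + sumL (visitSum χ) es)) →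
      ∃ λ l' →
        (∀ {φ} → Symmetric φ → walkSum φ l' + (φ α x₁ + φ α x₂) ≡ walkSum φ l + (φ α' x₁ + φ α' x₂)) ×
        (∀ χ → sumL χ l' + χ α ≡ sumL χ l + χ α')
    reroute α' l e₁ x₁ e₂ x₂ es end₁ end₂ walk-eq vertex-eq =
      -- The first excursion ends in `x₁` and goes on to `α'`; the second, reversed, leaves `α'`
      -- towards `x₂` and returns to `α`. The remaining excursions follow unchanged.
      α ∷ s₁ ++ α' ∷ (reverse s₂ ++ unroll es) , walks , vertices'
      where
      t₁ = turn e₁ x₁ end₁
      t₂ = turn e₂ x₂ end₂
      s₁ = Turned.sequence t₁
      s₂ = Turned.sequence t₂
      walks : ∀ {φ} → Symmetric φ → walkSum φ (α ∷ s₁ ++ α' ∷ (reverse s₂ ++ unroll es)) + (φ α x₁ + φ α x₂) ≡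
        walkSum φ l + (φ α' x₁ + φ α' x₂)
      walks {φ} s = begin
        pathSum φ α (s₁ ++ α' ∷ (reverse s₂ ++ unroll es)) α + (φ α x₁ + φ α x₂)
          ≡⟨ cong (_+ _) (pathSum-++ φ α s₁ α' _ α) ⟩
        pathSum φ α s₁ α' + pathSum φ α' (reverse s₂ ++ unroll es) α + (φ α x₁ + φ α x₂)
          ≡⟨ cong (λ z → pathSum φ α s₁ α' + z + (φ α x₁ + φ α x₂))
               (trans (pathSum-unroll φ α' (reverse s₂) es) (cong (_+ _) (pathSum-reverse s α' s₂ α))) ⟩
        pathSum φ α s₁ α' + (pathSum φ α s₂ α' + R) + (φ α x₁ + φ α x₂)
          ≡⟨ eq₁ (pathSum φ α s₁ α') (pathSum φ α s₂ α') R (φ α x₁) (φ α x₂) ⟩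
        (pathSum φ α s₁ α' + φ α x₁) + ((pathSum φ α s₂ α' + φ α x₂) + R)
          ≡⟨ cong₂ (λ y z → y + (z + R)) (Turned.path-eq t₁ s α') (Turned.path-eq t₂ s α') ⟩
        (excursionSum φ e₁ + φ α' x₁) + ((excursionSum φ e₂ + φ α' x₂) + R)
          ≡⟨ eq₁ (excursionSum φ e₁) (excursionSum φ e₂) R (φ α' x₁) (φ α' x₂) ⟨
        excursionSum φ e₁ + (excursionSum φ e₂ + R) + (φ α' x₁ + φ α' x₂)
          ≡⟨ cong (_+ _) (walk-eq φ) ⟨
        walkSum φ l + (φ α' x₁ + φ α' x₂) ∎
        where
        open ≡-Reasoning
        R = sumL (excursionSum φ) es
        eq₁ : ∀ a b r c d → a + (b + r) + (c + d) ≡ (a + c) + ((b + d) + r)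
        eq₁ = solve-∀
      vertices' : ∀ χ → sumL χ (α ∷ s₁ ++ α' ∷ (reverse s₂ ++ unroll es)) + χ α ≡ sumL χ l + χ α'
      vertices' χ rewrite sumL-++ χ s₁ (α' ∷ (reverse s₂ ++ unroll es)) | sumL-++ χ (reverse s₂) (unroll es)
        | sumL-reverse χ s₂ | Turned.vertices t₁ χ | Turned.vertices t₂ χ
        | sumL-concatMap χ (λ e → α ∷ proj₁ e ∷ proj₂ e) es | vertex-eq χ =
        eq (χ α) (χ (proj₁ e₁) + sumL χ (proj₂ e₁)) (χ α') (χ (proj₁ e₂) + sumL χ (proj₂ e₂)) (sumL (visitSum χ) es)
        where
        eq : ∀ a s b t r → a + (s + (b + (t + r))) + a ≡ a + s + (a + t + r) + b
        eq = solve-∀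

-- Splitting a vertex of weight at least two

concatFin : ∀ k → (Fin k → List A) → List A
concatFin zero    h = []
concatFin (suc k) h = h zero ++ concatFin k (h ∘ suc)

sumL-concatFin : ∀ k (f : A → ℕ) (h : Fin k → List A) →
  sumL f (concatFin k h) ≡ sumL (λ j → sumL f (h j)) (allFin k)
sumL-concatFin zero    f h = refl
sumL-concatFin (suc k) f h = trans (sumL-++ f (h zero) _)
  (trans (cong (sumL f (h zero) +_) (sumL-concatFin k f (h ∘ suc))) (sym (sumL-allFin-suc k _)))

-- The blocks are tied to `zs` by sums alone, which is enough for counting representatives.
Pointwise-concatFin⁻ : ∀ {R : A → B → Set} k (h : Fin k → List A) {zs} → Pointwise R (concatFin k h) zs →
  ∃ λ (us : Fin k → List B) → (∀ j → Pointwise R (h j) (us j)) ×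
    (∀ f → sumL f zs ≡ sumL (λ j → sumL f (us j)) (allFin k))
Pointwise-concatFin⁻ zero    h [] = (λ ()) , (λ ()) , λ f → refl
Pointwise-concatFin⁻ {R = R} (suc k) h pw with Pointwise-++⁻ (h zero) pw
... | us₀ , vs , refl , p , q with Pointwise-concatFin⁻ k (h ∘ suc) q
...   | us , ps , sums = us' , ps' , λ f → trans (sumL-++ f us₀ vs)
        (trans (cong (sumL f us₀ +_) (sums f)) (sym (sumL-allFin-suc k (λ j → sumL f (us' j)))))
  where
  us' : Fin (suc k) → List _
  us' zero    = us₀
  us' (suc j) = us j
  ps' : ∀ j → Pointwise R (h j) (us' j)
  ps' zero    = p
  ps' (suc j) = ps j

-- Expands K (p + i) (q + j) = K (a + i') (b + j'), all second-order terms in the indicators being zero.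
product-shift : ∀ K a b p q i j i' j' → p + i ≡ a + i' → q + j ≡ b + j' →
  K * (i * j) ≡ 0 → K * (i * j') ≡ 0 → K * (i' * j) ≡ 0 → K * (i' * j') ≡ 0 →
  K * (a * b) + (i' * (K * b) + j' * (K * a)) ≡ K * (p * q) + (i * (K * b) + j * (K * a))
product-shift K a b p q i j i' j' p-eq q-eq ij ij' i'j i'j' = begin
  K * (a * b) + (i' * (K * b) + j' * (K * a))
    ≡⟨ expand (K * (i' * j')) i'j' (eq₁ K a b i' j') ⟩
  K * ((a + i') * (b + j'))
    ≡⟨ cong₂ (λ x y → K * (x * y)) p-eq q-eq ⟨
  K * ((p + i) * (q + j))
    ≡⟨ expand (K * (i * j)) ij (eq₁ K p q i j) ⟨
  K * (p * q) + (i * (K * q) + j * (K * p))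
    ≡⟨ cong₂ (λ x y → K * (p * q) + (x + y)) (substitute i q b j j' q-eq ij ij')
         (substitute j p a i i' p-eq (trans (eq₂ K j i) ij) (trans (eq₂ K j i') i'j)) ⟩
  K * (p * q) + (i * (K * b) + j * (K * a)) ∎
  where
  open ≡-Reasoning
  eq₁ : ∀ K a b i j → K * (a * b) + (i * (K * b) + j * (K * a)) + K * (i * j) ≡ K * ((a + i) * (b + j))
  eq₁ = solve-∀
  eq₂ : ∀ K i j → K * (i * j) ≡ K * (j * i)
  eq₂ = solve-∀
  eq₃ : ∀ K i q j → i * (K * q) + K * (i * j) ≡ K * (i * (q + j))
  eq₃ = solve-∀
  expand : ∀ {x y} z → z ≡ 0 → x + z ≡ y → x ≡ y
  expand {x} .0 refl e = trans (sym (+-identityʳ x)) e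
  substitute : ∀ i q b j j' → q + j ≡ b + j' → K * (i * j) ≡ 0 → K * (i * j') ≡ 0 → i * (K * q) ≡ i * (K * b)
  substitute i q b j j' e ij ij' = trans (expand _ ij (eq₃ K i q j))
    (trans (cong (λ x → K * (i * x)) e) (sym (expand _ ij' (eq₃ K i b j'))))

bit : Bool → ℕ
bit true  = 1
bit false = 0

module Splitting {V : Set} (_≟V_ : DecidableEquality V) (k : ℕ) where

  open Walks _≟V_

  -- A column is either the far end of an edge at the split vertex or a spare slot of a colour.
  Column : Set
  Column = V ⊎ Fin k

  _≟C_ : DecidableEquality Column
  _≟C_ = ⊎-≡-dec _≟V_ _≟_

  real : (V → ℕ) → Column → ℕ
  real χ (inj₁ x) = χ x
  real χ (inj₂ _) = 0

  ι-inj₁ : ∀ x v → ι _≟C_ (inj₁ x) (inj₁ v) ≡ ι _≟V_ x v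
  ι-inj₁ x v = ⟦⟧-⇔ (inj₁ x ≟C inj₁ v) (x ≟V v) inj₁-injective (cong inj₁)

  ι-inj₂ : ∀ i j → ι _≟C_ (inj₂ i) (inj₂ j) ≡ ι _≟_ i j
  ι-inj₂ i j = ⟦⟧-⇔ (inj₂ i ≟C inj₂ j) (i ≟ j) inj₂-injective (cong inj₂)

  edgeSum : (V → V → ℕ) → List (V × V) → ℕ
  edgeSum φ = sumL (λ e → φ (proj₁ e) (proj₂ e))

  degSum : (V → ℕ) → List (V × V) → ℕ
  degSum χ = sumL (λ e → χ (proj₁ e) + χ (proj₂ e))

  module _ (α α' : V) (d : ℕ) where

    g : ℕ
    g = suc (suc d)

    Row : Set
    Row = Fin g → Column

    Transversal : List Row → List Column → Set
    Transversal = Pointwise (λ r x → ∃ λ i → x ≡ r i)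

    rowSum : (Column → ℕ) → List Row → ℕ
    rowSum f = sumL (λ r → sumL (f ∘ r) (allFin g))

    occurrences : Column → Column → ℕ
    occurrences b x = ι _≟C_ x b

    -- Interface between the representatives and the structures to be split. A walk or the factor
    -- supplies `rows`, and by `resolve` it is rebuilt from the entries picked there, provided that
    -- the number of spare picks is the prescribed one.
    record Piece (total : (V → V → ℕ) → ℕ) (spares : Fin k → ℕ) (Outcome : List Column → Set) : Set where
      field
        rows    : List Row
        degree  : ∀ v → rowSum (occurrences (inj₁ v)) rows ≡ total (link α v)
        spare   : ∀ i → rowSum (occurrences (inj₂ i)) rows ≡ g * spares i
        resolve : ∀ picks → Transversal rows picks →
          (∀ i → sumL (occurrences (inj₂ i)) picks ≡ spares i) → Outcome picks

    -- Serves to show that a column absent from the rows is absent from the picks.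
    transversal-≤ : ∀ f {R picks} → Transversal R picks → sumL f picks ≤ rowSum f R
    transversal-≤ f [] = z≤n
    transversal-≤ f {r ∷ _} ((i , refl) ∷ t) = +-mono-≤ (sumL-∈ (f ∘ r) (∈-allFin i)) (transversal-≤ f t)

    -- For each real pick `x` an edge from `α` to `x` becomes one from `α'` to `x`, and `e` visits
    -- pass from `α` to `α'`. Both balances are additive, without subtraction.
    WalkOutcome : List V → ℕ → List Column → Set
    WalkOutcome l e picks = ∃ λ l' →
      (∀ {φ} → Symmetric φ →
        walkSum φ l' + sumL (real (φ α)) picks ≡ walkSum φ l + sumL (real (φ α')) picks) ×
      (∀ χ → sumL χ l' + e * χ α ≡ sumL χ l + e * χ α')

    FactorOutcome : List (V × V) → Bool → List Column → Set
    FactorOutcome fac b picks = ∃ λ fac' →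
      (∀ {φ} → Symmetric φ →
        edgeSum φ fac' + sumL (real (φ α)) picks ≡ edgeSum φ fac + sumL (real (φ α')) picks) ×
      (∀ χ → degSum χ fac' + bit b * χ α ≡ degSum χ fac + bit b * χ α')

    excursionRow : Fin k → Excursion → Row
    excursionRow j (h , hs) zero          = inj₁ h
    excursionRow j (h , hs) (suc zero)    = inj₁ (final h hs)
    excursionRow j (h , hs) (suc (suc _)) = inj₂ j

    excursionRow-sum : ∀ f j h hs → sumL (f ∘ excursionRow j (h , hs)) (allFin g) ≡
      f (inj₁ h) + (f (inj₁ (final h hs)) + d * f (inj₂ j))
    excursionRow-sum f j h hs = trans (sumL-allFin-suc (suc d) (f ∘ excursionRow j (h , hs)))
      (cong (f (inj₁ h) +_) (trans (sumL-allFin-suc d (f ∘ excursionRow j (h , hs) ∘ suc))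
        (cong (f (inj₁ (final h hs)) +_) (sumL-allFin-const d _))))

    RowPick : Fin k → Excursion → Column → Set
    RowPick j e x = ∃ λ i → x ≡ excursionRow j e i

    realPick : ∀ {j es picks p} → Pointwise (RowPick j) es picks → sumL (real (λ _ → 1)) picks ≡ suc p →
      ∃ λ e → ∃ λ x → ∃ λ es' → ∃ λ picks' → EndOf α e x × Pointwise (RowPick j) es' picks' ×
        (∀ φ → sumL φ es ≡ φ e + sumL φ es') ×
        (∀ χ → sumL (real χ) picks ≡ χ x + sumL (real χ) picks')
    realPick {es = e ∷ es} ((zero , refl) ∷ pw) _ =
      e , _ , es , _ , inj₁ refl , pw , (λ φ → refl) , (λ χ → refl)
    realPick {es = e ∷ es} ((suc zero , refl) ∷ pw) _ =
      e , _ , es , _ , inj₂ refl , pw , (λ φ → refl) , (λ χ → refl)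
    realPick {es = e₀ ∷ es} ((suc (suc i) , refl) ∷ pw) n with realPick pw n
    ... | e , x , es' , picks' , end , pw' , se , sx =
      e , x , e₀ ∷ es' , _ , end , (suc (suc i) , refl) ∷ pw' ,
      (λ φ → trans (cong (φ e₀ +_) (se φ)) (eq (φ e₀) (φ e) _)) , sx
      where
      eq : ∀ a b c → a + (b + c) ≡ b + (a + c)
      eq = solve-∀

    noRealPick : ∀ {picks} → sumL (real (λ _ → 1)) picks ≡ 0 → ∀ χ → sumL (real χ) picks ≡ 0
    noRealPick {[]}          _ χ = refl
    noRealPick {inj₂ j ∷ xs} e χ = noRealPick {xs} e χ

    -- Each row gives one pick, which is either real or the spare of the colour `j`.
    realPicks-count : ∀ {j es picks} → Pointwise (RowPick j) es picks →
      sumL (real (λ _ → 1)) picks + sumL (occurrences (inj₂ j)) picks ≡ length es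
    realPicks-count [] = refl
    realPicks-count ((zero , refl) ∷ pw)       = cong suc (realPicks-count pw)
    realPicks-count ((suc zero , refl) ∷ pw)   = cong suc (realPicks-count pw)
    realPicks-count {j} ((suc (suc _) , refl) ∷ pw) rewrite ι-refl _≟C_ (inj₂ j) =
      trans (+-suc _ _) (cong suc (realPicks-count pw))

    twoRealPicks : ∀ {j es picks} → Pointwise (RowPick j) es picks → sumL (real (λ _ → 1)) picks ≡ 2 →
      ∃ λ e₁ → ∃ λ x₁ → ∃ λ e₂ → ∃ λ x₂ → ∃ λ es' → EndOf α e₁ x₁ × EndOf α e₂ x₂ ×
        (∀ φ → sumL φ es ≡ φ e₁ + (φ e₂ + sumL φ es')) ×
        (∀ χ → sumL (real χ) picks ≡ χ x₁ + χ x₂)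
    twoRealPicks pw two with realPick {p = 1} pw two
    ... | e₁ , x₁ , es₁ , picks₁ , end₁ , pw₁ , se₁ , sx₁
      with realPick {p = 0} pw₁ (suc-injective (trans (sym (sx₁ _)) two))
    ...   | e₂ , x₂ , es₂ , picks₂ , end₂ , pw₂ , se₂ , sx₂ =
      e₁ , x₁ , e₂ , x₂ , es₂ , end₁ , end₂ ,
      (λ φ → trans (se₁ φ) (cong (φ e₁ +_) (se₂ φ))) ,
      λ χ → trans (sx₁ χ) (cong (χ x₁ +_) (trans (sx₂ χ) (trans (cong (χ x₂ +_) (noRealPick {picks₂} none χ)) (+-identityʳ _))))
      where
      none : sumL (real (λ _ → 1)) picks₂ ≡ 0
      none = suc-injective (suc-injective
        (trans (sym (trans (sx₁ (λ _ → 1)) (cong suc (sx₂ (λ _ → 1))))) two))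

    -- There are `g` excursions and hence `g` picks. Exactly `d` of them are spare, which leaves
    -- `g - d = 2` real picks from two different excursions, as rerouting requires. The form `d * 1`
    -- is the value at `e = 1` of the `d * e` that occurs in `walkPiece`.
    visitedPiece : ∀ j l → sumL (λ x → ι _≟V_ x α) l ≡ g → walkSum (link α α) l ≡ 0 →
      Piece (λ φ → walkSum φ l) (λ i → ι _≟_ j i * (d * 1)) (WalkOutcome l 1)
    visitedPiece j l visits loopless = record
      { rows    = map (excursionRow j) list
      ; degree  = λ v → trans (sumL-map _ (excursionRow j) list)
          (trans (sumL-congAll (All.map (λ {e} → rowDegree v {e}) avoids)) (sym (walk-eq (link α v))))
      ; spare   = λ i → trans (sumL-map _ (excursionRow j) list)
          (trans (sumL-cong (λ e → trans (excursionRow-sum (occurrences (inj₂ i)) j (proj₁ e) (proj₂ e))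
              (trans (cong (d *_) (ι-inj₂ j i)) (trans (*-comm d _) (cong (ι _≟_ j i *_) (sym (*-identityʳ d)))))) list)
            (trans (sumL-const _ list) (cong (_* (ι _≟_ j i * (d * 1))) len)))
      ; resolve = λ picks t sp → resolve (unmap list t) (sp j) }
      where
      ex = excursions α l (subst (1 ≤_) (sym visits) (s≤s z≤n)) loopless
      open Excursions ex
      len : length list ≡ g
      len = trans (length-excursions α ex) visits
      rowDegree : ∀ v {e} → All (_≢ α) (proj₁ e ∷ proj₂ e) →
        sumL (occurrences (inj₁ v) ∘ excursionRow j e) (allFin g) ≡ excursionSum α (link α v) e
      rowDegree v {h , hs} av = trans (excursionRow-sum (occurrences (inj₁ v)) j h hs)
        (trans (cong₂ _+_ (ι-inj₁ h v) (trans (cong₂ _+_ (ι-inj₁ (final h hs) v) (*-zeroʳ d)) (+-identityʳ _)))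
          (sym (excursionSum-link α v h hs av)))
      unmap : ∀ es {picks} → Transversal (map (excursionRow j) es) picks → Pointwise (RowPick j) es picks
      unmap []       []      = []
      unmap (e ∷ es) (p ∷ t) = p ∷ unmap es t
      resolve : ∀ {picks} → Pointwise (RowPick j) list picks →
        sumL (occurrences (inj₂ j)) picks ≡ ι _≟_ j j * (d * 1) → WalkOutcome l 1 picks
      -- Real picks plus `d` equals `g`, that is, `2 + d`; cancelling `d` leaves two.
      resolve {picks} pw sp with twoRealPicks pw (+-cancelʳ-≡ d _ _
        (trans (cong (sumL (real (λ _ → 1)) picks +_)
          (sym (trans sp (trans (cong (_* (d * 1)) (ι-refl _≟_ j)) (trans (*-identityˡ _) (*-identityʳ d))))))
          (trans (realPicks-count pw) len)))
      ... | e₁ , x₁ , e₂ , x₂ , es' , end₁ , end₂ , se , sx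
        with reroute α α' l e₁ x₁ e₂ x₂ es' end₁ end₂ (λ φ → trans (walk-eq φ) (se _)) (λ χ → trans (vertices χ) (se _))
      ...   | l' , walks , vs = l' ,
        (λ {φ} s → trans (cong (walkSum φ l' +_) (sx (φ α)))
          (trans (walks s) (cong (walkSum φ l +_) (sym (sx (φ α')))))) ,
        λ χ → trans (cong (sumL χ l' +_) (*-identityˡ (χ α)))
          (trans (vs χ) (cong (sumL χ l +_) (sym (*-identityˡ (χ α')))))

    unvisitedPiece : ∀ j l → sumL (λ x → ι _≟V_ x α) l ≡ 0 →
      Piece (λ φ → walkSum φ l) (λ i → ι _≟_ j i * (d * 0)) (WalkOutcome l 0)
    unvisitedPiece j l unvisited = record
      { rows    = []
      ; degree  = λ v → sym (walk-0 v l unvisited)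
      ; spare   = λ i → sym (trans (cong (λ z → g * (ι _≟_ j i * z)) (*-zeroʳ d))
          (trans (cong (g *_) (*-zeroʳ (ι _≟_ j i))) (*-zeroʳ g)))
      ; resolve = λ { .[] [] _ → l , (λ _ → refl) , λ χ → refl } }
      where
      path-0 : ∀ v x xs y → sumL (λ z → ι _≟V_ z α) (x ∷ xs) ≡ 0 → ι _≟V_ y α ≡ 0 →
        pathSum (link α v) x xs y ≡ 0
      path-0 v x [] y e e' rewrite m+n≡0⇒m≡0 (ι _≟V_ x α) e | e' = *-zeroʳ (ι _≟V_ x v)
      path-0 v x (z ∷ xs) y e e'
        rewrite path-0 v z xs y (m+n≡0⇒n≡0 (ι _≟V_ x α) e) e' | m+n≡0⇒m≡0 (ι _≟V_ x α) e
              | m+n≡0⇒m≡0 (ι _≟V_ z α) (m+n≡0⇒n≡0 (ι _≟V_ x α) e) | *-zeroʳ (ι _≟V_ x v) = refl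
      walk-0 : ∀ v l → sumL (λ z → ι _≟V_ z α) l ≡ 0 → walkSum (link α v) l ≡ 0
      walk-0 v []       e = refl
      walk-0 v (x ∷ xs) e = path-0 v x xs x e (m+n≡0⇒m≡0 (ι _≟V_ x α) e)

    record Star (fac : List (V × V)) : Set where
      field
        nbrs     : List V
        rest     : List (V × V)
        edge-eq  : ∀ {φ} → Symmetric φ → edgeSum φ fac ≡ sumL (φ α) nbrs + edgeSum φ rest
        deg-eq   : ∀ χ → degSum χ fac ≡ sumL (λ y → χ α + χ y) nbrs + degSum χ rest
        avoids   : All (_≢ α) nbrs
        avoids-r : All (λ e → proj₁ e ≢ α × proj₂ e ≢ α) rest

    star : ∀ fac → edgeSum (link α α) fac ≡ 0 → Star fac
    star [] _ = record { nbrs = [] ; rest = [] ; edge-eq = λ _ → refl ; deg-eq = λ _ → refl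
      ; avoids = [] ; avoids-r = [] }
    star ((x , y) ∷ fac) e with star fac (m+n≡0⇒n≡0 (link α α x y) e)
    ... | record { nbrs = nb ; rest = re ; edge-eq = eq ; deg-eq = dq ; avoids = av ; avoids-r = ar }
      with x ≟V α | y ≟V α
    ...   | yes refl | yes refl = contradiction e λ ()
    ...   | yes refl | no y≢α = record { nbrs = y ∷ nb ; rest = re
            ; edge-eq = λ {φ} s → trans (cong (φ α y +_) (eq s)) (sym (+-assoc (φ α y) _ _))
            ; deg-eq = λ χ → trans (cong (χ α + χ y +_) (dq χ)) (sym (+-assoc (χ α + χ y) _ _))
            ; avoids = y≢α ∷ av ; avoids-r = ar }
    ...   | no x≢α | yes refl = record { nbrs = x ∷ nb ; rest = re
            ; edge-eq = λ {φ} s → trans (cong₂ _+_ (s x α) (eq s)) (sym (+-assoc (φ α x) _ _))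
            ; deg-eq = λ χ → trans (cong₂ _+_ (+-comm (χ x) (χ α)) (dq χ)) (sym (+-assoc (χ α + χ x) _ _))
            ; avoids = x≢α ∷ av ; avoids-r = ar }
    ...   | no x≢α | no y≢α = record { nbrs = nb ; rest = (x , y) ∷ re
            ; edge-eq = λ {φ} s → trans (cong (φ x y +_) (eq s)) (shift (φ x y) (sumL (φ α) nb) _)
            ; deg-eq = λ χ → trans (cong (χ x + χ y +_) (dq χ)) (shift (χ x + χ y) (sumL (λ z → χ α + χ z) nb) _)
            ; avoids = av ; avoids-r = (x≢α , y≢α) ∷ ar }
      where
      shift : ∀ a b c → a + (b + c) ≡ b + (a + c)
      shift = solve-∀

    -- If there is a factor, the `g` neighbours of `α` form a single row, and the edge to the picked
    -- neighbour is reattached to `α'`. Otherwise the degree of `α` is zero and nothing has to be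
    -- moved.
    factorPiece : ∀ b fac → degSum (λ x → ι _≟V_ x α) fac ≡ bit b * g → edgeSum (link α α) fac ≡ 0 →
      Piece (λ φ → edgeSum φ fac) (λ _ → 0) (FactorOutcome fac b)
    factorPiece b fac deg loopless = go b deg
      where
      open Star (star fac loopless)
      deg-nbrs : degSum (λ x → ι _≟V_ x α) fac ≡ length nbrs
      deg-nbrs = trans (deg-eq (λ x → ι _≟V_ x α)) (trans (cong₂ _+_ (count avoids) (none avoids-r)) (+-identityʳ _))
        where
        count : ∀ {xs} → All (_≢ α) xs → sumL (λ y → ι _≟V_ α α + ι _≟V_ y α) xs ≡ length xs
        count []       = refl
        count (p ∷ ps) = cong₂ _+_ (cong₂ _+_ (ι-refl _≟V_ α) (ι-≢ _≟V_ p)) (count ps)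
        none : ∀ {es} → All (λ e → proj₁ e ≢ α × proj₂ e ≢ α) es → degSum (λ x → ι _≟V_ x α) es ≡ 0
        none []             = refl
        none ((p , q) ∷ ps) rewrite ι-≢ _≟V_ p | ι-≢ _≟V_ q = none ps
      edges-link : ∀ v → edgeSum (link α v) fac ≡ sumL (λ y → ι _≟V_ y v) nbrs
      edges-link v = trans (edge-eq (link-sym α v)) (trans (cong₂ _+_ (ends avoids) (none avoids-r)) (+-identityʳ _))
        where
        ends : ∀ {xs} → All (_≢ α) xs → sumL (link α v α) xs ≡ sumL (λ y → ι _≟V_ y v) xs
        ends []       = refl
        ends {x ∷ xs} (p ∷ ps) = cong₂ _+_ (end p) (ends ps)
          where
          end : x ≢ α → link α v α x ≡ ι _≟V_ x v
          end p rewrite ι-refl _≟V_ α | ι-≢ _≟V_ p | *-zeroʳ (ι _≟V_ α v) =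
            trans (+-identityʳ _) (+-identityʳ _)
        none : ∀ {es} → All (λ e → proj₁ e ≢ α × proj₂ e ≢ α) es → edgeSum (link α v) es ≡ 0
        none []             = refl
        none {(x , y) ∷ _} ((p , q) ∷ ps) rewrite ι-≢ _≟V_ p | ι-≢ _≟V_ q | *-zeroʳ (ι _≟V_ x v) = none ps
      go : ∀ b → degSum (λ x → ι _≟V_ x α) fac ≡ bit b * g →
        Piece (λ φ → edgeSum φ fac) (λ _ → 0) (FactorOutcome fac b)
      go false deg with nbrs | trans (sym deg-nbrs) deg | edges-link
      ... | [] | refl | links = record
        { rows = [] ; degree = λ v → sym (links v) ; spare = λ i → sym (*-zeroʳ g)
        ; resolve = λ { .[] [] _ → fac , (λ _ → refl) , λ χ → refl } }
      go true deg = record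
        { rows    = (λ i → inj₁ (entry i)) ∷ []
        ; degree  = λ v → trans (+-identityʳ _)
            (trans (sumL-cong (λ i → ι-inj₁ (entry i) v) (allFin g)) (trans (sum-all _) (sym (edges-link v))))
        ; spare   = λ i → trans (+-identityʳ _) (trans (sumL-0 (allFin g)) (sym (*-zeroʳ g)))
        ; resolve = λ { (_ ∷ []) ((i , refl) ∷ []) _ → resolve i } }
        where
        -- The degree of `α` turns the length of `nbrs` into `g`, so that the neighbours fill
        -- exactly one row.
        open Enumeration (subst (λ n → Enumeration n nbrs)
          (trans (sym deg-nbrs) (trans deg (*-identityˡ g))) (enumerate nbrs))
        resolve : ∀ i → FactorOutcome fac true (inj₁ (entry i) ∷ [])
        resolve i = (α' , entry i) ∷ map (α ,_) (without i) ++ rest ,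
          edges , degs
          where
          edges : ∀ {φ} → Symmetric φ →
            edgeSum φ ((α' , entry i) ∷ map (α ,_) (without i) ++ rest) + (φ α (entry i) + 0) ≡
            edgeSum φ fac + (φ α' (entry i) + 0)
          edges {φ} s
            rewrite sumL-++ (λ e → φ (proj₁ e) (proj₂ e)) (map (α ,_) (without i)) rest
                  | sumL-map (λ e → φ (proj₁ e) (proj₂ e)) (α ,_) (without i)
                  | edge-eq s | sum-one i (φ α) =
            eq (φ α' (entry i)) (sumL (φ α) (without i)) (edgeSum φ rest) (φ α (entry i))
            where
            eq : ∀ a s r c → a + (s + r) + (c + 0) ≡ c + s + r + (a + 0)
            eq = solve-∀
          degs : ∀ χ → degSum χ ((α' , entry i) ∷ map (α ,_) (without i) ++ rest) + (χ α + 0) ≡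
            degSum χ fac + (χ α' + 0)
          degs χ
            rewrite sumL-++ (λ e → χ (proj₁ e) + χ (proj₂ e)) (map (α ,_) (without i)) rest
                  | sumL-map (λ e → χ (proj₁ e) + χ (proj₂ e)) (α ,_) (without i)
                  | deg-eq χ | sum-one i (λ y → χ α + χ y) =
            eq (χ α') (χ (entry i)) (sumL (λ y → χ α + χ y) (without i)) (degSum χ rest) (χ α)
            where
            eq : ∀ a x s r c → a + x + (s + r) + (c + 0) ≡ c + x + s + r + (a + 0)
            eq = solve-∀

  -- Realizations of a weight function and the splitting of one vertex

  module Detachment (K : V → V → ℕ) (K-sym : ∀ u v → K u v ≡ K v u) (K-loop : ∀ u → K u u ≡ 0)
    (member : Fin k → V → ℕ) (member-bit : ∀ j u → member j u ≡ 0 ⊎ member j u ≡ 1) (b : Bool)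
    (Vs : List V) (complete : ∀ v → v ∈ Vs) where

    -- Weight `m` on one vertex of each part and 0 elsewhere describes the amalgamated graph. Weight
    -- 1 everywhere describes `K` itself; then the walks are cycles and `matching` is a 1-factor or
    -- empty.
    record Realization (w : V → ℕ) : Set where
      field
        walk    : Fin k → List V
        matching  : List (V × V)
        visits  : ∀ j u → sumL (λ x → ι _≟V_ x u) (walk j) ≡ w u * member j u
        degrees : ∀ u → degSum (λ x → ι _≟V_ x u) matching ≡ bit b * w u
        joins   : ∀ u v → sumL (λ j → walkSum (link u v) (walk j)) (allFin k) + edgeSum (link u v) matching ≡
                  K u v * (w u * w v)

    -- Abstracts two vertices of one part. Since `K` has no loops, twins are nonadjacent.
    Twins : V → V → Set
    Twins α α' = (∀ v → K α v ≡ K α' v) × (∀ j → member j α ≡ member j α')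

    module _ (α α' : V) (twins : Twins α α') (d : ℕ) {w w' : V → ℕ} (wα : w α ≡ suc (suc d))
      (w'-eq : ∀ u → w' u + ι _≟V_ u α ≡ w u + ι _≟V_ u α') (S : Realization w) where

      open Realization S

      loopless : sumL (λ j → walkSum (link α α) (walk j)) (allFin k) + edgeSum (link α α) matching ≡ 0
      loopless = trans (joins α α) (cong (_* (w α * w α)) (K-loop α))

      walkSpares : Fin k → Fin k → ℕ
      walkSpares j i = ι _≟_ j i * (d * member j α)

      walkPiece : ∀ j → Piece α α' d (λ φ → walkSum φ (walk j)) (walkSpares j)
        (WalkOutcome α α' d (walk j) (member j α))
      walkPiece j = go (member j α) (member-bit j α) (trans (visits j α) (cong (_* member j α) wα))
        where
        -- `member j α` is generalized to `e`, so that its two possible values can be matched.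
        go : ∀ e → e ≡ 0 ⊎ e ≡ 1 → sumL (λ x → ι _≟V_ x α) (walk j) ≡ suc (suc d) * e →
          Piece α α' d (λ φ → walkSum φ (walk j)) (λ i → ι _≟_ j i * (d * e)) (WalkOutcome α α' d (walk j) e)
        go .0 (inj₁ refl) v = unvisitedPiece α α' d j (walk j) (trans v (*-zeroʳ d))
        go .1 (inj₂ refl) v = visitedPiece α α' d j (walk j) (trans v (*-identityʳ (suc (suc d))))
          (sumL-≡0 (λ j → walkSum (link α α) (walk j)) (m+n≡0⇒m≡0 _ loopless) (∈-allFin j))

      edgePiece : Piece α α' d (λ φ → edgeSum φ matching) (λ _ → 0) (FactorOutcome α α' d matching b)
      edgePiece = factorPiece α α' d b matching (trans (degrees α) (cong (bit b *_) wα))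
        (m+n≡0⇒n≡0 (sumL (λ j → walkSum (link α α) (walk j)) (allFin k)) loopless)

      open Piece

      allRows : List (Row α α' d)
      allRows = rows edgePiece ++ concatFin k (λ j → rows (walkPiece j))

      rowSum-all : ∀ f → rowSum α α' d f allRows ≡
        rowSum α α' d f (rows edgePiece) + sumL (λ j → rowSum α α' d f (rows (walkPiece j))) (allFin k)
      rowSum-all f = trans (sumL-++ _ (rows edgePiece) _)
        (cong (rowSum α α' d f (rows edgePiece) +_) (sumL-concatFin k _ (λ j → rows (walkPiece j))))

      -- One `g`-th of the total frequency, where `g = w α`: there are `K α v * (g * w v)` edges
      -- between `α` and `v`, and `g * d` spare entries for each walk that visits `α`.
      quota : Column → ℕ
      quota (inj₁ v) = K α v * w v
      quota (inj₂ i) = d * member i α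

      regular : ∀ c → rowSum α α' d (occurrences α α' d c) allRows ≡ suc (suc d) * quota c
      regular (inj₁ v) = begin
        rowSum α α' d (occurrences α α' d (inj₁ v)) allRows
          ≡⟨ rowSum-all (occurrences α α' d (inj₁ v)) ⟩
        _ ≡⟨ cong₂ _+_ (degree edgePiece v) (sumL-cong (λ j → degree (walkPiece j) v) (allFin k)) ⟩
        edgeSum (link α v) matching + sumL (λ j → walkSum (link α v) (walk j)) (allFin k)
          ≡⟨ +-comm (edgeSum (link α v) matching) _ ⟩
        _ ≡⟨ joins α v ⟩
        K α v * (w α * w v)
          ≡⟨ cong (λ z → K α v * (z * w v)) wα ⟩
        K α v * (suc (suc d) * w v)
          ≡⟨ eq (K α v) (suc (suc d)) (w v) ⟩
        suc (suc d) * (K α v * w v) ∎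
        where
        open ≡-Reasoning
        eq : ∀ a b c → a * (b * c) ≡ b * (a * c)
        eq = solve-∀
      regular (inj₂ i) = begin
        rowSum α α' d (occurrences α α' d (inj₂ i)) allRows
          ≡⟨ rowSum-all (occurrences α α' d (inj₂ i)) ⟩
        _ ≡⟨ cong₂ _+_ (trans (spare edgePiece i) (*-zeroʳ (suc (suc d))))
               (sumL-cong (λ j → spare (walkPiece j) i) (allFin k)) ⟩
        sumL (λ j → suc (suc d) * walkSpares j i) (allFin k)
          ≡⟨ sumL-*ˡ (suc (suc d)) (λ j → walkSpares j i) (allFin k) ⟩
        suc (suc d) * sumL (λ j → walkSpares j i) (allFin k)
          ≡⟨ cong (suc (suc d) *_) (sumL-ι i (λ j → d * member j α)) ⟩
        suc (suc d) * (d * member i α) ∎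
        where open ≡-Reasoning

      columns : List Column
      columns = map inj₁ Vs ++ map inj₂ (allFin k)

      columns-complete : ∀ c → c ∈ columns
      columns-complete (inj₁ v) = ∈-++⁺ˡ (∈-map⁺ inj₁ (complete v))
      columns-complete (inj₂ i) = ∈-++⁺ʳ (map inj₁ Vs) (∈-map⁺ inj₂ (∈-allFin i))

      splitVertex : Realization w'
      splitVertex
        -- `zero` takes the first of the levelled columns; any other would serve as well.
        with Representatives.represent _≟C_ columns columns-complete (suc (suc d)) quota zero allRows regular
      ... | picks , t , counts with Pointwise-++⁻ (rows edgePiece) t
      ...   | edgePicks , rest , refl , te , tr with Pointwise-concatFin⁻ k (λ j → rows (walkPiece j)) tr
      ...     | walkPicks , tw , rest-sum = record
        { walk = λ j → proj₁ (walkOut j) ; matching = proj₁ edgeOut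
        ; visits = visits' ; degrees = degrees' ; joins = joins' }
        where
        spareCount : Fin k → Fin k → ℕ
        spareCount i j = sumL (occurrences α α' d (inj₂ i)) (walkPicks j)

        edgeSpare : ∀ i → sumL (occurrences α α' d (inj₂ i)) edgePicks ≡ 0
        edgeSpare i = n≤0⇒n≡0 (≤-trans (transversal-≤ α α' d (occurrences α α' d (inj₂ i)) te)
          (≤-reflexive (trans (spare edgePiece i) (*-zeroʳ (suc (suc d))))))

        foreignSpare : ∀ {i j} → j ≢ i → spareCount i j ≡ 0
        foreignSpare {i} {j} j≢i = n≤0⇒n≡0 (≤-trans (transversal-≤ α α' d (occurrences α α' d (inj₂ i)) (tw j))
          (≤-reflexive (trans (spare (walkPiece j) i)
            (trans (cong (λ z → suc (suc d) * (z * (d * member j α))) (ι-≢ _≟_ j≢i)) (*-zeroʳ (suc (suc d)))))))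

        localize : ∀ i j → spareCount i j ≡ ι _≟_ j i * spareCount i j
        localize i j with j ≟ i
        ... | yes refl = sym (*-identityˡ _)
        ... | no j≢i   = foreignSpare j≢i

        -- The global quota of the spare column `i` becomes local, since neither the factor nor any
        -- other walk has rows containing it.
        ownSpare : ∀ i → spareCount i i ≡ d * member i α
        ownSpare i = begin
          spareCount i i
            ≡⟨ sumL-ι i (spareCount i) ⟨
          sumL (λ j → ι _≟_ j i * spareCount i j) (allFin k)
            ≡⟨ sumL-cong (localize i) (allFin k) ⟨
          sumL (spareCount i) (allFin k)
            ≡⟨ rest-sum (occurrences α α' d (inj₂ i)) ⟨
          sumL (occurrences α α' d (inj₂ i)) rest
            ≡⟨ cong (_+ _) (edgeSpare i) ⟨
          sumL (occurrences α α' d (inj₂ i)) edgePicks + sumL (occurrences α α' d (inj₂ i)) rest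
            ≡⟨ sumL-++ _ edgePicks rest ⟨
          sumL (occurrences α α' d (inj₂ i)) (edgePicks ++ rest)
            ≡⟨ counts (inj₂ i) ⟩
          d * member i α ∎
          where open ≡-Reasoning

        walkSpare : ∀ j i → spareCount i j ≡ walkSpares j i
        walkSpare j i with j ≟ i
        ... | yes refl = trans (ownSpare j) (sym (*-identityˡ _))
        ... | no j≢i   = foreignSpare j≢i

        walkOut : ∀ j → WalkOutcome α α' d (walk j) (member j α) (walkPicks j)
        walkOut j = resolve (walkPiece j) (walkPicks j) (tw j) (walkSpare j)

        edgeOut : FactorOutcome α α' d matching b edgePicks
        edgeOut = resolve edgePiece edgePicks te edgeSpare

        -- `f` is the same at both twins, so moving `f α` units from `α` to `α'` matches moving one
        -- unit of weight; each indicator lets `f` be evaluated at `u`.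
        transfer : ∀ {n n' u} (f : V → ℕ) → f α ≡ f α' →
          n' + f α * ι _≟V_ α u ≡ n + f α * ι _≟V_ α' u → n ≡ w u * f u → n' ≡ w' u * f u
        transfer {n} {n'} {u} f f-twin e n-eq = +-cancelʳ-≡ (ι _≟V_ u α * f u) n' (w' u * f u) (begin
          n' + ι _≟V_ u α * f u       ≡⟨ cong (n' +_) (at α) ⟨
          n' + f α * ι _≟V_ α u       ≡⟨ e ⟩
          n + f α * ι _≟V_ α' u       ≡⟨ cong₂ _+_ n-eq (trans (cong (_* ι _≟V_ α' u) f-twin) (at α')) ⟩
          w u * f u + ι _≟V_ u α' * f u   ≡⟨ *-distribʳ-+ (f u) (w u) _ ⟨
          (w u + ι _≟V_ u α') * f u   ≡⟨ cong (_* f u) (w'-eq u) ⟨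
          (w' u + ι _≟V_ u α) * f u   ≡⟨ *-distribʳ-+ (f u) (w' u) _ ⟩
          w' u * f u + ι _≟V_ u α * f u ∎)
          where
          open ≡-Reasoning
          at : ∀ x → f x * ι _≟V_ x u ≡ ι _≟V_ u x * f u
          at x = trans (*-comm (f x) _) (trans (cong (_* f x) (ι-sym _≟V_ x u)) (sym (ι-* _≟V_ f u x)))

        visits' : ∀ j u → sumL (λ x → ι _≟V_ x u) (proj₁ (walkOut j)) ≡ w' u * member j u
        visits' j u = transfer (member j) (proj₂ twins j)
          (proj₂ (proj₂ (walkOut j)) (λ x → ι _≟V_ x u)) (visits j u)

        degrees' : ∀ u → degSum (λ x → ι _≟V_ x u) (proj₁ edgeOut) ≡ bit b * w' u
        degrees' u = trans (transfer (λ _ → bit b) refl (proj₂ (proj₂ edgeOut) (λ x → ι _≟V_ x u))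
          (trans (degrees u) (*-comm (bit b) (w u)))) (*-comm (w' u) (bit b))

        -- How many picked edges join `u` and `v` when their near end is placed at `a`; used with
        -- `a = α` and `a = α'`.
        moved : V → V → V → ℕ
        moved u v a = ι _≟V_ a u * (K u v * w v) + ι _≟V_ a v * (K u v * w u)

        picked : ∀ u v a → (∀ x → K α x ≡ K a x) →
          sumL (real (link u v a)) (edgePicks ++ rest) ≡ moved u v a
        picked u v a K-eq = begin
          sumL (real (link u v a)) (edgePicks ++ rest)
            ≡⟨ sumL-cong split (edgePicks ++ rest) ⟩
          sumL (λ x → ι _≟V_ a u * occurrences α α' d (inj₁ v) x + ι _≟V_ a v * occurrences α α' d (inj₁ u) x) (edgePicks ++ rest)
            ≡⟨ sumL-+ _ _ (edgePicks ++ rest) ⟩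
          _ ≡⟨ cong₂ _+_ (sumL-*ˡ (ι _≟V_ a u) _ (edgePicks ++ rest)) (sumL-*ˡ (ι _≟V_ a v) _ (edgePicks ++ rest)) ⟩
          _ ≡⟨ cong₂ (λ y z → ι _≟V_ a u * y + ι _≟V_ a v * z) (counts (inj₁ v)) (counts (inj₁ u)) ⟩
          ι _≟V_ a u * (K α v * w v) + ι _≟V_ a v * (K α u * w u)
            ≡⟨ cong₂ _+_
                 (trans (cong (λ z → ι _≟V_ a u * (z * w v)) (K-eq v)) (ι-* _≟V_ (λ z → K z v * w v) a u))
                 (trans (cong (λ z → ι _≟V_ a v * (z * w u)) (K-eq u))
                   (trans (ι-* _≟V_ (λ z → K z u * w u) a v) (cong (λ z → ι _≟V_ a v * (z * w u)) (K-sym v u)))) ⟩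
          moved u v a ∎
          where
          open ≡-Reasoning
          split : ∀ x → real (link u v a) x ≡
            ι _≟V_ a u * occurrences α α' d (inj₁ v) x + ι _≟V_ a v * occurrences α α' d (inj₁ u) x
          split (inj₁ x) = cong₂ (λ y z → ι _≟V_ a u * y + ι _≟V_ a v * z) (sym (ι-inj₁ x v)) (sym (ι-inj₁ x u))
          split (inj₂ i) = sym (cong₂ _+_ (*-zeroʳ (ι _≟V_ a u)) (*-zeroʳ (ι _≟V_ a v)))

        picks-sum : ∀ f → sumL f (edgePicks ++ rest) ≡ sumL f edgePicks + sumL (λ j → sumL f (walkPicks j)) (allFin k)
        picks-sum f = trans (sumL-++ f edgePicks rest) (cong (sumL f edgePicks +_) (rest-sum f))

        total total' : (V → V → ℕ) → ℕ
        total  φ = sumL (λ j → walkSum φ (walk j)) (allFin k) + edgeSum φ matching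
        total' φ = sumL (λ j → walkSum φ (proj₁ (walkOut j))) (allFin k) + edgeSum φ (proj₁ edgeOut)

        total-change : ∀ {φ} → Symmetric φ →
          total' φ + sumL (real (φ α)) (edgePicks ++ rest) ≡ total φ + sumL (real (φ α')) (edgePicks ++ rest)
        total-change {φ} s = begin
          total' φ + sumL (real (φ α)) (edgePicks ++ rest)
            ≡⟨ cong (total' φ +_) (picks-sum (real (φ α))) ⟩
          _ ≡⟨ merge (λ j → walkSum φ (proj₁ (walkOut j))) (edgeSum φ (proj₁ edgeOut)) (φ α) ⟩
          _ ≡⟨ cong₂ _+_ (sumL-cong (λ j → proj₁ (proj₂ (walkOut j)) s) (allFin k)) (proj₁ (proj₂ edgeOut) s) ⟩
          _ ≡⟨ merge (λ j → walkSum φ (walk j)) (edgeSum φ matching) (φ α') ⟨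
          _ ≡⟨ cong (total φ +_) (picks-sum (real (φ α'))) ⟨
          total φ + sumL (real (φ α')) (edgePicks ++ rest) ∎
          where
          open ≡-Reasoning
          merge : ∀ f n χ →
            sumL f (allFin k) + n + (sumL (real χ) edgePicks + sumL (λ j → sumL (real χ) (walkPicks j)) (allFin k)) ≡
            sumL (λ j → f j + sumL (real χ) (walkPicks j)) (allFin k) + (n + sumL (real χ) edgePicks)
          merge f n χ = trans (eq (sumL f (allFin k)) n (sumL (real χ) edgePicks) _)
            (cong (_+ (n + sumL (real χ) edgePicks)) (sym (sumL-+ f _ (allFin k))))
            where
            eq : ∀ a b c e → a + b + (c + e) ≡ (a + e) + (b + c)
            eq = solve-∀

        -- Makes the second-order terms of `product-shift` vanish: an edge between `u` and `v` never
        -- has both ends in the nonadjacent set of `α` and `α'`.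
        disjoint : ∀ x y u v → K x y ≡ 0 → K u v * (ι _≟V_ u x * ι _≟V_ v y) ≡ 0
        disjoint x y u v K0 with u ≟V x | v ≟V y
        ... | yes refl | yes refl = cong (_* 1) K0
        ... | yes _    | no _     = *-zeroʳ (K u v)
        ... | no _     | _        = *-zeroʳ (K u v)

        joins' : ∀ u v → total' (link u v) ≡ K u v * (w' u * w' v)
        -- The edges removed from `α` are added on both sides. Then the total changes by the picked
        -- edges exactly as the product of weights changes to first order.
        joins' u v = +-cancelʳ-≡ (moved u v α) _ _ (begin
          total' (link u v) + moved u v α
            ≡⟨ cong (total' (link u v) +_) (picked u v α (λ _ → refl)) ⟨
          total' (link u v) + sumL (real (link u v α)) (edgePicks ++ rest)
            ≡⟨ total-change (link-sym u v) ⟩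
          total (link u v) + sumL (real (link u v α')) (edgePicks ++ rest)
            ≡⟨ cong₂ _+_ (joins u v) (picked u v α' (proj₁ twins)) ⟩
          K u v * (w u * w v) + moved u v α'
            ≡⟨ weights ⟩
          K u v * (w' u * w' v) + moved u v α ∎)
          where
          open ≡-Reasoning
          K-twin' : K α α' ≡ 0
          K-twin' = trans (proj₁ twins α') (K-loop α')
          weights : K u v * (w u * w v) + moved u v α' ≡ K u v * (w' u * w' v) + moved u v α
          weights rewrite ι-sym _≟V_ α u | ι-sym _≟V_ α v | ι-sym _≟V_ α' u | ι-sym _≟V_ α' v =
            product-shift (K u v) (w u) (w v) (w' u) (w' v) _ _ _ _ (w'-eq u) (w'-eq v)
              (disjoint α α u v (K-loop α)) (disjoint α α' u v K-twin')
              (disjoint α' α u v (trans (K-sym α' α) K-twin')) (disjoint α' α' u v (K-loop α'))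

-- Indicators, vectors and repeated lists

⟦⟧-× : {P Q : Set} (d : Dec P) (e : Dec Q) → ⟦ d ×-dec e ⟧ ≡ ⟦ d ⟧ * ⟦ e ⟧
⟦⟧-× (yes _) (yes _) = refl
⟦⟧-× (yes _) (no _)  = refl
⟦⟧-× (no _)  _       = refl

sumL-Vec : ∀ {k} (f : A → ℕ) (xs : Vec A k) →
  Vec.sum (Vec.map f xs) ≡ sumL (λ j → f (lookup xs j)) (allFin k)
sumL-Vec f Vec.[]       = refl
sumL-Vec {k = suc k} f (x Vec.∷ xs) = trans (cong (f x +_) (sumL-Vec f xs)) (sym (sumL-allFin-suc k _))

length-filter : ∀ {P : A → Set} (P? : ∀ x → Dec (P x)) xs → length (filter P? xs) ≡ sumL (λ x → ⟦ P? x ⟧) xs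
length-filter P? []       = refl
length-filter P? (x ∷ xs) with P? x
... | yes _ = cong suc (length-filter P? xs)
... | no _  = length-filter P? xs

repeat : ℕ → List A → List A
repeat zero    l = []
repeat (suc t) l = l ++ repeat t l

sumL-repeat : ∀ (f : A → ℕ) t l → sumL f (repeat t l) ≡ t * sumL f l
sumL-repeat f zero    l = refl
sumL-repeat f (suc t) l = trans (sumL-++ f l (repeat t l)) (cong (sumL f l +_) (sumL-repeat f t l))

-- Multiplicities in lists

module Counting (_≟A_ : DecidableEquality A) where

  count : A → List A → ℕ
  count u = sumL (λ x → ι _≟A_ x u)

  ∈⇒count : ∀ {u xs} → u ∈ xs → 1 ≤ count u xs
  ∈⇒count {u} u∈ = ≤-trans (≤-reflexive (sym (ι-refl _≟A_ u))) (sumL-∈ (λ x → ι _≟A_ x u) u∈)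

  count⇒∈ : ∀ {u} xs → 1 ≤ count u xs → u ∈ xs
  count⇒∈ {u} (x ∷ xs) le with x ≟A u
  ... | yes refl = here refl
  ... | no _     = there (count⇒∈ xs le)

  count-≢ : ∀ {u xs} → All (u ≢_) xs → count u xs ≡ 0
  count-≢ []       = refl
  count-≢ {u} (p ∷ ps) rewrite ι-≢ _≟A_ (p ∘ sym) = count-≢ ps

  Unique⇒count : ∀ u {xs} → Unique xs → count u xs ≡ 0 ⊎ count u xs ≡ 1
  Unique⇒count u [] = inj₁ refl
  Unique⇒count u {x ∷ _} (p ∷ ps) with x ≟A u
  ... | yes refl = inj₂ (cong suc (count-≢ p))
  ... | no _     = Unique⇒count u ps

  count⇒Unique : ∀ xs → (∀ u → count u xs ≤ 1) → Unique xs
  count⇒Unique []       _  = []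
  count⇒Unique (x ∷ xs) le =
    All.tabulate (λ { {y} y∈ refl → <-irrefl refl (≤-trans (s≤s (∈⇒count y∈))
      (subst (λ z → z + count x xs ≤ 1) (ι-refl _≟A_ x) (le x))) })
    ∷ count⇒Unique xs (λ u → ≤-trans (m≤n+m _ (ι _≟A_ x u)) (le u))

length≥2 : {x y : A} {xs : List A} → x ∈ xs → y ∈ xs → x ≢ y → 2 ≤ length xs
length≥2 {xs = _ ∷ []}     (here refl) (here refl) x≢y = contradiction refl x≢y
length≥2 {xs = _ ∷ _ ∷ _} _ _ _ = s≤s (s≤s z≤n)

-- Cycles as closed walks

module CycleSums {V : Set} (_≟V_ : DecidableEquality V) where

  open Walks _≟V_

  walkSum-zip : ∀ φ x xs z → sumL (λ e → φ (proj₁ e) (proj₂ e)) (zip (x ∷ xs) (xs ++ [ z ])) ≡ pathSum φ x xs z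
  walkSum-zip φ x []       z = +-identityʳ _
  walkSum-zip φ x (y ∷ xs) z = cong (φ x y +_) (walkSum-zip φ y xs z)

  -- For `u ≢ v` an edge cannot run in both directions at once, so the indicator of the disjunction
  -- is the sum of the two products in `link`.
  edgeCount-walkSum : ∀ {u v} → u ≢ v → ∀ C → edgeCount _≟V_ u v C ≡ walkSum (link u v) (verts C)
  edgeCount-walkSum {u} {v} u≢v C = trans (length-filter _ (cycleEdges (verts C)))
    (trans (sumL-cong (λ e → link-⟦⟧ (proj₁ e) (proj₂ e)) (cycleEdges (verts C))) (go (verts C)))
    where
    link-⟦⟧ : ∀ x y → ⟦ ((x ≟V u) ×-dec (y ≟V v)) ⊎-dec ((x ≟V v) ×-dec (y ≟V u)) ⟧ ≡ link u v x y
    link-⟦⟧ x y with x ≟V u | x ≟V v | y ≟V u | y ≟V v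
    ... | yes refl | yes refl | _ | _ = contradiction refl u≢v
    ... | _ | _ | yes refl | yes refl = contradiction refl u≢v
    ... | yes _ | no _  | yes _ | no _  = refl
    ... | yes _ | no _  | no _  | yes _ = refl
    ... | yes _ | no _  | no _  | no _  = refl
    ... | no _  | yes _ | yes _ | no _  = refl
    ... | no _  | yes _ | no _  | yes _ = refl
    ... | no _  | yes _ | no _  | no _  = refl
    ... | no _  | no _  | yes _ | no _  = refl
    ... | no _  | no _  | no _  | yes _ = refl
    ... | no _  | no _  | no _  | no _  = refl
    go : ∀ l → sumL (λ e → link u v (proj₁ e) (proj₂ e)) (cycleEdges l) ≡ walkSum (link u v) l
    go []       = refl
    go (x ∷ xs) = walkSum-zip (link u v) x xs x

  link-≢ : ∀ u {x y} → x ≢ y → link u u x y ≡ 0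
  link-≢ u {x} {y} x≢y with x ≟V u | y ≟V u
  ... | yes refl | yes refl = contradiction refl x≢y
  ... | yes _    | no _     = refl
  ... | no _     | _        = refl

  cycle-loopless : ∀ u C → walkSum (link u u) (verts C) ≡ 0
  cycle-loopless u (mkCycle (x ∷ []) _ (s≤s ()))
  cycle-loopless u (mkCycle (x ∷ y ∷ xs) ((x≢y ∷ x≢) ∷ uniq) _) rewrite link-≢ u x≢y = path y xs uniq (x≢y ∘ sym) x≢
    where
    path : ∀ z zs → Unique (z ∷ zs) → z ≢ x → All (x ≢_) zs → pathSum (link u u) z zs x ≡ 0
    path z []       _ z≢x _ = link-≢ u z≢x
    path z (w ∷ zs) ((z≢w ∷ _) ∷ uq) _ (x≢w ∷ ps) rewrite link-≢ u z≢w = path w zs uq (x≢w ∘ sym) ps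

  walkSum-repeat : ∀ φ t l → walkSum φ (repeat t l) ≡ t * walkSum φ l
  walkSum-repeat φ zero    l        = refl
  walkSum-repeat φ (suc t) []       = walkSum-repeat φ t []
  walkSum-repeat φ (suc t) (x ∷ xs) = go t
    where
    go : ∀ t → pathSum φ x (xs ++ repeat t (x ∷ xs)) x ≡ suc t * pathSum φ x xs x
    go zero    = trans (cong (λ l → pathSum φ x l x) (List.++-identityʳ xs)) (sym (+-identityʳ _))
    go (suc t) = trans (pathSum-++ φ x xs x (xs ++ repeat t (x ∷ xs)) x) (cong (pathSum φ x xs x +_) (go t))

  link-swap : ∀ u v x y → link u v x y ≡ link v u x y
  link-swap u v x y = +-comm (ι _≟V_ x u * ι _≟V_ y v) _

  degree : V → List (V × V) → ℕ
  degree u = sumL (λ e → ι _≟V_ (proj₁ e) u + ι _≟V_ (proj₂ e) u)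
  edges : V → V → List (V × V) → ℕ
  edges u v = sumL (λ e → link u v (proj₁ e) (proj₂ e))

  edges-0 : ∀ u v es → degree u es ≡ 0 → edges u v es ≡ 0
  edges-0 u v []             _ = refl
  edges-0 u v ((x , y) ∷ es) e
    rewrite m+n≡0⇒m≡0 (ι _≟V_ x u) (m+n≡0⇒m≡0 _ e) | m+n≡0⇒n≡0 (ι _≟V_ x u) (m+n≡0⇒m≡0 _ e)
          | *-zeroʳ (ι _≟V_ x v) = edges-0 u v es (m+n≡0⇒n≡0 (ι _≟V_ x u + ι _≟V_ y u) e)

  -- Degree one leaves a single edge at `u`, and it is no loop because a loop would contribute 2.
  -- Its other end is `p`.
  partner : ∀ u es → degree u es ≡ 1 → ∃ λ p → ∀ v → edges u v es ≡ ι _≟V_ p v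
  partner u ((x , y) ∷ es) e with x ≟V u | y ≟V u
  ... | yes refl | yes refl = contradiction e λ ()
  ... | yes refl | no _ = y , λ v → trans (cong₂ _+_
          (trans (cong₂ _+_ (*-identityˡ _) (*-zeroʳ (ι _≟V_ x v))) (+-identityʳ _)) (edges-0 x v es (suc-injective e))) (+-identityʳ _)
  ... | no _ | yes refl = x , λ v → trans (cong₂ _+_ (*-identityʳ _) (edges-0 y v es (suc-injective e))) (+-identityʳ _)
  ... | no _ | no _ with partner u es e
  ...   | p , eq = p , λ v → trans (cong (_+ edges u v es) (*-zeroʳ (ι _≟V_ x v))) (eq v)

-- The edge list of a 1-factor

module FactorEdges {n : ℕ} (f : Fin n → Fin n) (invol : ∀ x → f (f x) ≡ x) (fixfree : ∀ x → f x ≢ x) where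

  open Walks (_≟_ {n})

  -- Each matching edge is listed from its smaller end only; otherwise the involution would produce
  -- it twice.
  up : Fin n → ℕ
  up x = ⟦ x Fin.<? f x ⟧

  factorEdge : Fin n → List (Fin n × Fin n)
  factorEdge x = if does (x Fin.<? f x) then [ (x , f x) ] else []

  factorEdges : List (Fin n × Fin n)
  factorEdges = concatMap factorEdge (allFin n)

  sumL-factorEdges : ∀ (h : Fin n × Fin n → ℕ) → sumL h factorEdges ≡ sumL (λ x → up x * h (x , f x)) (allFin n)
  sumL-factorEdges h = trans (sumL-concatMap h factorEdge (allFin n)) (sumL-cong go (allFin n))
    where
    select : ∀ {P : Set} (d : Dec P) e → sumL h (if does d then [ e ] else []) ≡ ⟦ d ⟧ * h e
    select (yes _) e = refl
    select (no _)  e = refl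
    go : ∀ x → sumL h (factorEdge x) ≡ up x * h (x , f x)
    go x = select (x Fin.<? f x) (x , f x)

  up-once : ∀ x → up x + up (f x) ≡ 1
  up-once x rewrite invol x with Fin.<-cmp x (f x)
  ... | tri< lt _ ¬gt = cong₂ _+_ (⟦yes⟧ (x Fin.<? f x) lt) (⟦no⟧ (f x Fin.<? x) ¬gt)
  ... | tri≈ _ eq _   = contradiction (sym eq) (fixfree x)
  ... | tri> ¬lt _ gt = cong₂ _+_ (⟦no⟧ (x Fin.<? f x) ¬lt) (⟦yes⟧ (f x Fin.<? x) gt)

  ι-partner : ∀ x c → ι _≟_ (f x) c ≡ ι _≟_ x (f c)
  ι-partner x c = ⟦⟧-⇔ (f x ≟ c) (x ≟ f c) (λ { refl → sym (invol x) }) (λ { refl → invol c })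

  factor-degree : ∀ c → sumL (λ e → ι _≟_ (proj₁ e) c + ι _≟_ (proj₂ e) c) factorEdges ≡ 1
  factor-degree c = begin
    sumL (λ e → ι _≟_ (proj₁ e) c + ι _≟_ (proj₂ e) c) factorEdges
      ≡⟨ sumL-factorEdges _ ⟩
    sumL (λ x → up x * (ι _≟_ x c + ι _≟_ (f x) c)) (allFin n)
      ≡⟨ sumL-cong (λ x → trans (cong (λ z → up x * (ι _≟_ x c + z)) (ι-partner x c)) (eq (up x) (ι _≟_ x c) _)) (allFin n) ⟩
    sumL (λ x → ι _≟_ x c * up x + ι _≟_ x (f c) * up x) (allFin n)
      ≡⟨ sumL-+ (λ x → ι _≟_ x c * up x) _ (allFin n) ⟩
    _ ≡⟨ cong₂ _+_ (sumL-ι c up) (sumL-ι (f c) up) ⟩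
    up c + up (f c)
      ≡⟨ up-once c ⟩
    1 ∎
    where
    open ≡-Reasoning
    eq : ∀ a b c → a * (b + c) ≡ b * a + c * a
    eq = solve-∀

  -- The edge may be listed from `c` or from `e`. If `f c` is `e`, exactly one of `up c` and `up e`
  -- is 1; if not, both terms vanish.
  factor-edges : ∀ c e → sumL (λ p → link c e (proj₁ p) (proj₂ p)) factorEdges ≡ ι _≟_ (f c) e
  factor-edges c e = begin
    sumL (λ p → link c e (proj₁ p) (proj₂ p)) factorEdges
      ≡⟨ sumL-factorEdges _ ⟩
    sumL (λ x → up x * link c e x (f x)) (allFin n)
      ≡⟨ sumL-cong (λ x → eq (up x) (ι _≟_ x c) (ι _≟_ (f x) e) (ι _≟_ x e) (ι _≟_ (f x) c)) (allFin n) ⟩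
    sumL (λ x → ι _≟_ x c * (up x * ι _≟_ (f x) e) + ι _≟_ x e * (up x * ι _≟_ (f x) c)) (allFin n)
      ≡⟨ sumL-+ (λ x → ι _≟_ x c * (up x * ι _≟_ (f x) e)) _ (allFin n) ⟩
    _ ≡⟨ cong₂ _+_ (sumL-ι c (λ x → up x * ι _≟_ (f x) e)) (sumL-ι e (λ x → up x * ι _≟_ (f x) c)) ⟩
    up c * ι _≟_ (f c) e + up e * ι _≟_ (f e) c
      ≡⟨ cong (λ z → up c * ι _≟_ (f c) e + up e * z) (trans (ι-partner e c) (ι-sym _≟_ e (f c))) ⟩
    up c * ι _≟_ (f c) e + up e * ι _≟_ (f c) e
      ≡⟨ eq' (up c) (up e) (ι _≟_ (f c) e) ⟩
    ι _≟_ (f c) e * up c + ι _≟_ (f c) e * up e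
      ≡⟨ cong (ι _≟_ (f c) e * up c +_) (ι-* _≟_ up (f c) e) ⟨
    ι _≟_ (f c) e * up c + ι _≟_ (f c) e * up (f c)
      ≡⟨ *-distribˡ-+ (ι _≟_ (f c) e) (up c) _ ⟨
    ι _≟_ (f c) e * (up c + up (f c))
      ≡⟨ trans (cong (ι _≟_ (f c) e *_) (up-once c)) (*-identityʳ _) ⟩
    ι _≟_ (f c) e ∎
    where
    open ≡-Reasoning
    eq : ∀ u a b c d → u * (a * b + c * d) ≡ a * (u * b) + c * (u * d)
    eq = solve-∀
    eq' : ∀ a b c → a * c + b * c ≡ c * a + c * b
    eq' = solve-∀

-- From the amalgamated graph to the complete multipartite graph

module Blowup (lam n m' k : ℕ) (b : Bool)
  (D : CycleDecomposition (_≟_ {n}) (λmKn lam (suc m') n) b k) where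

  m : ℕ
  m = suc m'

  V : Set
  V = Fin n × Fin m

  K : Multigraph V
  K = λKnm lam n m

  K-sym : ∀ u v → K u v ≡ K v u
  K-sym (a , _) (c , _) with a ≟ c | c ≟ a
  ... | yes _    | yes _  = refl
  ... | yes refl | no p   = contradiction refl p
  ... | no p     | yes e  = contradiction (sym e) p
  ... | no _     | no _   = refl

  K-loop : ∀ u → K u u ≡ 0
  K-loop (a , _) with a ≟ a
  ... | yes _ = refl
  ... | no p  = contradiction refl p

  K-part : ∀ a x x' v → K (a , x) v ≡ K (a , x') v
  K-part a x x' (c , _) with a ≟ c
  ... | yes _ = refl
  ... | no _  = refl

  open Counting

  member : Fin k → V → ℕ
  member j (a , _) = count _≟_ a (verts (lookup (cycles D) j))

  member-bit : ∀ j u → member j u ≡ 0 ⊎ member j u ≡ 1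
  member-bit j (a , _) = Unique⇒count _≟_ a (distinct (lookup (cycles D) j))

  vertices : List V
  vertices = cartesianProduct (allFin n) (allFin m)

  vertices-complete : ∀ v → v ∈ vertices
  vertices-complete (a , x) = ∈-cartesianProduct⁺ (∈-allFin a) (∈-allFin x)

  open Walks {V} _≟V_
  open CycleSums {V} _≟V_
  open Splitting {V} _≟V_ k
  open Detachment K K-sym K-loop member member-bit b vertices vertices-complete

  private
    module B where
      open Walks (_≟_ {n}) public
      open CycleSums (_≟_ {n}) public

  ι-pair : ∀ a x c y → ι (_≟V_ {n} {m}) (a , x) (c , y) ≡ ι _≟_ a c * ι _≟_ x y
  ι-pair a x c y = trans
    (⟦⟧-⇔ ((a , x) ≟V (c , y)) ((a ≟ c) ×-dec (x ≟ y)) (λ { refl → refl , refl }) (λ { (refl , refl) → refl }))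
    (⟦⟧-× (a ≟ c) (x ≟ y))

  -- Amalgamation: each part starts as its vertex (a , zero) with weight m.
  base : Fin n → V
  base a = a , zero

  initialWeight : V → ℕ
  initialWeight (a , x) = ι _≟_ zero x * m

  baseFactor : ∀ b → FactorSlot _≟_ (λmKn lam m n) b → List (Fin n × Fin n)
  baseFactor true  (f , invol , fixfree , _) = FactorEdges.factorEdges f invol fixfree
  baseFactor false _                         = []

  baseFactor-degree : ∀ b F c → B.degree c (baseFactor b F) ≡ bit b
  baseFactor-degree true  (f , invol , fixfree , _) c = FactorEdges.factor-degree f invol fixfree c
  baseFactor-degree false _ c = refl

  baseFactor-edges : ∀ b F c e → B.edges c e (baseFactor b F) ≡ slotCount _≟_ {λmKn lam m n} b F c e
  baseFactor-edges true  (f , invol , fixfree , _) c e with f c ≟ e | FactorEdges.factor-edges f invol fixfree c e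
  ... | yes _ | eq = eq
  ... | no _  | eq = eq
  baseFactor-edges false _ c e = refl

  slotCount-loop : ∀ b F c → slotCount _≟_ {λmKn lam m n} b F c c ≡ 0
  slotCount-loop true (f , _ , fixfree , _) c with f c ≟ c
  ... | yes e = contradiction e (fixfree c)
  ... | no _  = refl
  slotCount-loop false _ c = refl

  baseFac : List (Fin n × Fin n)
  baseFac = baseFactor b (factor D)

  -- For distinct `c` and `e` this is `covers`. On the diagonal, about which `covers` says nothing,
  -- both sides vanish because cycles and factor have no loops.
  base-joins : ∀ c e x y →
    sumL (λ j → B.walkSum (B.link c e) (verts (lookup (cycles D) j))) (allFin k) + B.edges c e baseFac ≡
    K (c , x) (e , y) * m
  base-joins c e x y with c ≟ e
  ... | yes refl = cong₂ _+_
    (trans (sumL-cong (λ j → B.cycle-loopless c (lookup (cycles D) j)) (allFin k)) (sumL-0 (allFin k)))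
    (trans (baseFactor-edges b (factor D) c c) (slotCount-loop b (factor D) c))
  ... | no c≢e = trans (cong₂ _+_
    (trans (sumL-cong (λ j → sym (B.edgeCount-walkSum c≢e (lookup (cycles D) j))) (allFin k))
      (sym (sumL-Vec (edgeCount _≟_ c e) (cycles D))))
    (baseFactor-edges b (factor D) c e)) (covers D c e c≢e)

  link-base : ∀ c x e y a a' →
    link (c , x) (e , y) (base a) (base a') ≡ (ι _≟_ zero x * ι _≟_ zero y) * B.link c e a a'
  link-base c x e y a a'
    rewrite ι-pair a zero c x | ι-pair a' zero e y | ι-pair a zero e y | ι-pair a' zero c x =
    eq (ι _≟_ a c) (ι _≟_ zero x) (ι _≟_ a' e) (ι _≟_ zero y) (ι _≟_ a e) (ι _≟_ a' c)
    where
    eq : ∀ p x q y r s → p * x * (q * y) + r * y * (s * x) ≡ (x * y) * (p * q + r * s)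
    eq = solve-∀

  pathSum-map : ∀ φ a l c → pathSum φ (base a) (map base l) (base c) ≡
    B.pathSum (λ x y → φ (base x) (base y)) a l c
  pathSum-map φ a []      c = refl
  pathSum-map φ a (x ∷ l) c = cong (φ (base a) (base x) +_) (pathSum-map φ x l c)

  pathSum-*ˡ : ∀ t (φ ψ : Fin n → Fin n → ℕ) → (∀ a c → φ a c ≡ t * ψ a c) →
    ∀ a l c → B.pathSum φ a l c ≡ t * B.pathSum ψ a l c
  pathSum-*ˡ t φ ψ eq a []      c = eq a c
  pathSum-*ˡ t φ ψ eq a (x ∷ l) c =
    trans (cong₂ _+_ (eq a x) (pathSum-*ˡ t φ ψ eq x l c)) (sym (*-distribˡ-+ t (ψ a x) _))

  walkSum-base : ∀ c x e y l →
    walkSum (link (c , x) (e , y)) (map base l) ≡ (ι _≟_ zero x * ι _≟_ zero y) * B.walkSum (B.link c e) l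
  walkSum-base c x e y []      = sym (*-zeroʳ (ι _≟_ zero x * ι _≟_ zero y))
  walkSum-base c x e y (a ∷ l) = trans (pathSum-map _ a l a) (pathSum-*ˡ (ι _≟_ zero x * ι _≟_ zero y) _ (B.link c e) (link-base c x e y) a l a)

  -- Going round everything `m` times multiplies the `lam * m` edges between two parts by `m`, which
  -- agrees with `lam` times the product of the two weights `m`.
  initial : Realization initialWeight
  initial = record
    { walk     = λ j → repeat m (map base (verts (lookup (cycles D) j)))
    ; matching = repeat m (map (λ e → base (proj₁ e) , base (proj₂ e)) baseFac)
    ; visits   = visits ; degrees = degrees ; joins = joins }
    where
    visits : ∀ j u → count _≟V_ u (repeat m (map base (verts (lookup (cycles D) j)))) ≡ initialWeight u * member j u
    visits j (c , x) = begin
      count _≟V_ (c , x) (repeat m (map base l))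
        ≡⟨ sumL-repeat _ m (map base l) ⟩
      m * count _≟V_ (c , x) (map base l)
        ≡⟨ cong (m *_) (trans (sumL-map _ base l)
             (trans (sumL-cong (λ a → trans (ι-pair a zero c x) (*-comm (ι _≟_ a c) _)) l) (sumL-*ˡ (ι _≟_ zero x) _ l))) ⟩
      m * (ι _≟_ zero x * count _≟_ c l)
        ≡⟨ eq m (ι _≟_ zero x) (count _≟_ c l) ⟩
      ι _≟_ zero x * m * count _≟_ c l ∎
      where
      open ≡-Reasoning
      l = verts (lookup (cycles D) j)
      eq : ∀ a b c → a * (b * c) ≡ b * a * c
      eq = solve-∀
    degrees : ∀ u → degree u (repeat m (map (λ e → base (proj₁ e) , base (proj₂ e)) baseFac)) ≡ bit b * initialWeight u
    degrees (c , x) = begin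
      degree (c , x) (repeat m lifted)
        ≡⟨ sumL-repeat _ m lifted ⟩
      m * degree (c , x) lifted
        ≡⟨ cong (m *_) (trans (sumL-map _ _ baseFac)
             (trans (sumL-cong (λ e → trans (cong₂ _+_ (ι-pair (proj₁ e) zero c x) (ι-pair (proj₂ e) zero c x))
                      (eq₁ (ι _≟_ (proj₁ e) c) (ι _≟_ zero x) (ι _≟_ (proj₂ e) c))) baseFac)
               (trans (sumL-*ˡ (ι _≟_ zero x) _ baseFac) (cong (ι _≟_ zero x *_) (baseFactor-degree b (factor D) c))))) ⟩
      m * (ι _≟_ zero x * bit b)
        ≡⟨ eq₂ m (ι _≟_ zero x) (bit b) ⟩
      bit b * (ι _≟_ zero x * m) ∎
      where
      open ≡-Reasoning
      lifted = map (λ e → base (proj₁ e) , base (proj₂ e)) baseFac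
      eq₁ : ∀ a x b → a * x + b * x ≡ x * (a + b)
      eq₁ = solve-∀
      eq₂ : ∀ a x b → a * (x * b) ≡ b * (x * a)
      eq₂ = solve-∀
    joins : ∀ u v →
      sumL (λ j → walkSum (link u v) (repeat m (map base (verts (lookup (cycles D) j))))) (allFin k) +
        edges u v (repeat m (map (λ e → base (proj₁ e) , base (proj₂ e)) baseFac)) ≡
      K u v * (initialWeight u * initialWeight v)
    joins (c , x) (e , y) = begin
      sumL (λ j → walkSum φ (repeat m (map base (l j)))) (allFin k) + edges (c , x) (e , y) (repeat m lifted)
        ≡⟨ cong₂ _+_
             (trans (sumL-cong (λ j → trans (walkSum-repeat φ m (map base (l j)))
               (trans (cong (m *_) (walkSum-base c x e y (l j))) (sym (*-assoc m z _)))) (allFin k)) (sumL-*ˡ (m * z) _ (allFin k)))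
             (trans (sumL-repeat _ m lifted) (trans (cong (m *_) (trans (sumL-map _ _ baseFac)
               (trans (sumL-cong (λ p → link-base c x e y (proj₁ p) (proj₂ p)) baseFac) (sumL-*ˡ z _ baseFac))))
               (sym (*-assoc m z _)))) ⟩
      m * z * sumL (λ j → B.walkSum (B.link c e) (l j)) (allFin k) + m * z * B.edges c e baseFac
        ≡⟨ *-distribˡ-+ (m * z) _ (B.edges c e baseFac) ⟨
      m * z * (sumL (λ j → B.walkSum (B.link c e) (l j)) (allFin k) + B.edges c e baseFac)
        ≡⟨ cong (m * z *_) (base-joins c e x y) ⟩
      m * z * (K (c , x) (e , y) * m)
        ≡⟨ eq m (ι _≟_ zero x) (ι _≟_ zero y) (K (c , x) (e , y)) ⟩
      K (c , x) (e , y) * (ι _≟_ zero x * m * (ι _≟_ zero y * m)) ∎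
      where
      open ≡-Reasoning
      φ = link (c , x) (e , y)
      l : Fin k → List (Fin n)
      l j = verts (lookup (cycles D) j)
      z = ι _≟_ zero x * ι _≟_ zero y
      lifted = map (λ e → base (proj₁ e) , base (proj₂ e)) baseFac
      eq : ∀ m x y K → m * (x * y) * (K * m) ≡ K * (x * m * (y * m))
      eq = solve-∀

  Realization-resp : ∀ {w w'} → (∀ u → w u ≡ w' u) → Realization w → Realization w'
  Realization-resp e S = record
    { walk = walk ; matching = matching
    ; visits  = λ j u → trans (visits j u) (cong (_* member j u) (e u))
    ; degrees = λ u → trans (degrees u) (cong (bit b *_) (e u))
    ; joins   = λ u v → trans (joins u v) (cong (K u v *_) (cong₂ _*_ (e u) (e v))) }
    where open Realization S

  -- Weights after the vertices (a , suc x) with x < r a have been split off from (a , zero).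
  weight : (Fin n → ℕ) → V → ℕ
  weight r (a , zero)  = m ∸ r a
  weight r (a , suc x) = ⟦ toℕ x <? r a ⟧

  advance : ∀ r a (x : Fin m') → r a ≡ toℕ x → Realization (weight r) →
    Realization (weight (λ c → r c + ι _≟_ c a))
  -- The last number is the current weight `m ∸ toℕ x` of `(a , zero)` minus 2. As `toℕ x < m'`,
  -- this weight is indeed at least 2.
  advance r a x ra = splitVertex (a , zero) (a , suc x) (K-part a zero (suc x) , λ j → refl) (m' ∸ suc (toℕ x))
    heavy change
    where
    x<m' : toℕ x < m'
    x<m' = toℕ<n x
    heavy : m ∸ r a ≡ suc (suc (m' ∸ suc (toℕ x)))
    heavy rewrite ra = trans (+-∸-assoc 1 (<⇒≤ x<m')) (cong suc (∸-suc x<m'))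
      where
      ∸-suc : ∀ {p q} → p < q → q ∸ p ≡ suc (q ∸ suc p)
      ∸-suc {p} {q} p<q = +-∸-assoc 1 p<q
    change : ∀ u → weight (λ c → r c + ι _≟_ c a) u + ι _≟V_ u (a , zero) ≡ weight r u + ι _≟V_ u (a , suc x)
    change (c , zero) rewrite ι-pair c zero a zero | ι-pair c zero a (suc x) with c ≟ a
    ... | no _     = cong (λ z → m ∸ z + 0) (+-identityʳ (r c))
    ... | yes refl rewrite ra = begin
      m ∸ (toℕ x + 1) + 1     ≡⟨ cong (λ z → m ∸ z + 1) (+-comm (toℕ x) 1) ⟩
      m' ∸ toℕ x + 1          ≡⟨ +-comm (m' ∸ toℕ x) 1 ⟩
      suc (m' ∸ toℕ x)        ≡⟨ +-∸-assoc 1 (<⇒≤ x<m') ⟨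
      m ∸ toℕ x               ≡⟨ +-identityʳ _ ⟨
      m ∸ toℕ x + 0           ∎
      where open ≡-Reasoning
    change (c , suc y) rewrite ι-pair c (suc y) a zero | ι-pair c (suc y) a (suc x) with c ≟ a
    ... | no _     = cong (λ z → ⟦ toℕ y <? z ⟧ + 0) (+-identityʳ (r c))
    ... | yes refl rewrite ra | +-comm (toℕ x) 1 with <-cmp (toℕ y) (toℕ x)
    ...   | tri< y<x y≢x _ = cong₂ _+_
      (trans (⟦yes⟧ (toℕ y <? suc (toℕ x)) (m<n⇒m<1+n y<x)) (sym (⟦yes⟧ (toℕ y <? toℕ x) y<x)))
      (sym (cong (_+ 0) (ι-≢ _≟_ (y≢x ∘ cong toℕ ∘ Fin.suc-injective))))
    ...   | tri≈ y≮x y≡x _ = trans (cong (_+ 0) (⟦yes⟧ (toℕ y <? suc (toℕ x)) (s≤s (≤-reflexive y≡x))))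
      (sym (cong₂ _+_ (⟦no⟧ (toℕ y <? toℕ x) y≮x)
        (cong (_+ 0) (⟦yes⟧ (suc y ≟ suc x) (cong suc (toℕ-injective y≡x))))))
    ...   | tri> y≮x y≢x x<y = trans (cong (_+ 0) (⟦no⟧ (toℕ y <? suc (toℕ x)) (λ y<1+x → <⇒≱ x<y (≤-pred y<1+x))))
      (sym (cong₂ _+_ (⟦no⟧ (toℕ y <? toℕ x) y≮x)
        (cong (_+ 0) (ι-≢ _≟_ (y≢x ∘ cong toℕ ∘ Fin.suc-injective)))))

  -- `N` bounds the number of splittings still to be done. When every `r a` has reached `m'`, the
  -- base vertices have weight `m ∸ m' = 1` like all others.
  complete : ∀ N r → (∀ a → r a ≤ m') → sumL (λ a → m' ∸ r a) (allFin n) ≤ N →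
    Realization (weight r) → Realization (λ _ → 1)
  complete N r r≤ le S with Fin.any? (λ a → r a <? m')
  ... | no ¬lt = Realization-resp full S
    where
    r≡ : ∀ a → r a ≡ m'
    r≡ a = ≤-antisym (r≤ a) (≮⇒≥ (λ lt → ¬lt (a , lt)))
    full : ∀ u → weight r u ≡ 1
    full (a , zero)  rewrite r≡ a = m+n∸n≡m 1 m'
    full (a , suc x) rewrite r≡ a = ⟦yes⟧ (toℕ x <? m') (toℕ<n x)
  complete zero    r r≤ le S | yes (a , lt) =
    contradiction (m∸n≡0⇒m≤n (sumL-≡0 (λ c → m' ∸ r c) (n≤0⇒n≡0 le) (∈-allFin a))) (<⇒≱ lt)
  complete (suc N) r r≤ le S | yes (a , lt) = complete N r' r'≤
    (≤-pred (≤-trans (sumL-mono-< (λ c → ∸-monoʳ-≤ m' (m≤m+n (r c) _)) (∈-allFin a) less) le))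
    (advance r a (fromℕ< lt) (sym (toℕ-fromℕ< lt)) S)
    where
    r' : Fin n → ℕ
    r' c = r c + ι _≟_ c a
    r'≤ : ∀ c → r' c ≤ m'
    r'≤ c with c ≟ a
    ... | yes refl = subst (_≤ m') (+-comm 1 (r a)) lt
    ... | no _     = subst (_≤ m') (sym (+-identityʳ (r c))) (r≤ c)
    less : m' ∸ r' a < m' ∸ r a
    less rewrite ι-refl _≟_ a | +-comm (r a) 1 = ∸-monoʳ-< (n<1+n (r a)) lt

  split : Realization (λ _ → 1)
  split = complete _ (λ _ → 0) (λ _ → z≤n) ≤-refl (Realization-resp start initial)
    where
    start : ∀ u → initialWeight u ≡ weight (λ _ → 0) u
    start (a , zero)  = *-identityˡ m
    start (a , suc x) = refl

  -- The decomposition read off at unit weights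

  open Realization split using (visits; degrees; joins) renaming (walk to blownUp; matching to splitFactor)

  visits₁ : ∀ j u → count _≟V_ u (blownUp j) ≡ member j u
  visits₁ j u = trans (visits j u) (*-identityˡ _)

  blownUp-member : ∀ j a x → ((a , x) ∈ blownUp j) ⇔ (a ∈ verts (lookup (cycles D) j))
  blownUp-member j a x = mk⇔
    (λ u∈ → count⇒∈ _≟_ _ (subst (1 ≤_) (visits₁ j (a , x)) (∈⇒count _≟V_ u∈)))
    (λ a∈ → count⇒∈ _≟V_ _ (subst (1 ≤_) (sym (visits₁ j (a , x))) (∈⇒count _≟_ a∈)))

  -- A walk that meets every vertex at most once is a cycle once it has length at least 2. The
  -- copies `(a , zero)` and `(c , zero)` of two vertices of the given cycle guarantee this length.
  blownUp-cycle : Fin k → Cycle V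
  blownUp-cycle j = mkCycle (blownUp j)
    (count⇒Unique _≟V_ (blownUp j) (λ u → subst (_≤ 1) (sym (visits₁ j u)) (atMostOne (member-bit j u))))
    (long (lookup (cycles D) j) (λ a → Equivalence.from (blownUp-member j a zero)))
    where
    atMostOne : ∀ {x} → x ≡ 0 ⊎ x ≡ 1 → x ≤ 1
    atMostOne (inj₁ refl) = z≤n
    atMostOne (inj₂ refl) = ≤-refl
    long : ∀ C → (∀ a → a ∈ verts C → (a , zero) ∈ blownUp j) → 2 ≤ length (blownUp j)
    long (mkCycle (a ∷ []) _ (s≤s ())) _
    long (mkCycle (a ∷ c ∷ _) ((a≢c ∷ _) ∷ _) _) f =
      length≥2 (f a (here refl)) (f c (there (here refl))) (a≢c ∘ cong proj₁)

  edges-≤ : ∀ u v → edges u v splitFactor ≤ K u v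
  edges-≤ u v = subst (edges u v splitFactor ≤_) (trans (joins u v) (*-identityʳ (K u v))) (m≤n+m _ _)

  -- If there is a factor, all degrees are one and partners define `f`: symmetry of `link` makes it
  -- an involution, `joins` bounds its edges by `K`, and a fixed point would need a loop of `K`.
  -- Without a factor all degrees are zero, so no edge is left.
  newFactor : ∀ b → (∀ u → degree u splitFactor ≡ bit b * 1) → Σ (FactorSlot _≟V_ K b) λ F →
    ∀ u v → edges u v splitFactor ≡ slotCount _≟V_ {K} b F u v
  newFactor false deg = _ , λ u v → edges-0 u v splitFactor (deg u)
  newFactor true  deg = (f , invol , fixfree , adjacent) , slot
    where
    f : V → V
    f u = proj₁ (partner u splitFactor (deg u))
    f-edges : ∀ u v → edges u v splitFactor ≡ ι _≟V_ (f u) v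
    f-edges u = proj₂ (partner u splitFactor (deg u))
    f-edge : ∀ u → edges u (f u) splitFactor ≡ 1
    f-edge u = trans (f-edges u (f u)) (ι-refl _≟V_ (f u))
    ι-≡ : ∀ {u v} → ι _≟V_ u v ≡ 1 → u ≡ v
    ι-≡ {u} {v} e with u ≟V v
    ... | yes p = p
    ... | no _  = contradiction e λ ()
    invol : ∀ u → f (f u) ≡ u
    invol u = ι-≡ (trans (sym (f-edges (f u) u))
      (trans (sumL-cong (λ e → link-swap (f u) u (proj₁ e) (proj₂ e)) splitFactor) (f-edge u)))
    adjacent : ∀ u → 1 ≤ K u (f u)
    adjacent u = subst (_≤ K u (f u)) (f-edge u) (edges-≤ u (f u))
    fixfree : ∀ u → f u ≢ u
    fixfree u e = contradiction (subst (1 ≤_) (trans (cong (K u) e) (K-loop u)) (adjacent u)) λ ()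
    slot : ∀ u v → edges u v splitFactor ≡ slotCount _≟V_ {K} true (f , invol , fixfree , adjacent) u v
    slot u v = trans (f-edges u v) (go u v)
      where
      go : ∀ u v → ι _≟V_ (f u) v ≡ factorCount _≟V_ {K} (f , invol , fixfree , adjacent) u v
      go u v with f u ≟V v
      ... | yes _ = refl
      ... | no _  = refl

  blownUp-decomposition : CycleDecomposition _≟V_ K b k
  blownUp-decomposition = record
    { cycles = Vec.tabulate blownUp-cycle
    ; factor = proj₁ (newFactor b degrees)
    ; covers = λ u v u≢v → trans (cong₂ _+_
        (trans (sumL-Vec (edgeCount _≟V_ u v) (Vec.tabulate blownUp-cycle))
          (sumL-cong (λ j → trans (cong (edgeCount _≟V_ u v) (lookup∘tabulate blownUp-cycle j))
            (edgeCount-walkSum u≢v (blownUp-cycle j))) (allFin k)))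
        (sym (proj₂ (newFactor b degrees) u v)))
        (trans (joins u v) (*-identityʳ (K u v))) }

  blownUp-vertices : ∀ i a x →
    ((a , x) ∈ verts (lookup (cycles blownUp-decomposition) i)) ⇔ (a ∈ verts (lookup (cycles D) i))
  blownUp-vertices i a x rewrite lookup∘tabulate blownUp-cycle i = blownUp-member i a x

theorem3p2 : (lam m n k : ℕ) → 1 ≤ lam → 1 ≤ m → 1 ≤ n →
    (D : CycleDecomposition _≟_ (λmKn lam m n) (oddDeg lam m n) k) →
    Σ (CycleDecomposition _≟V_ (λKnm lam n m) (oddDeg lam m n) k) λ D' →
    ∀ (i : Fin k) (a : Fin n) (b : Fin m) →
    ((a , b) ∈ verts (lookup (cycles D') i)) ⇔ (a ∈ verts (lookup (cycles D) i))
-- Writing the size as `suc m'` provides the vertex `(a , zero)` of each part, from which the others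
-- are split off.
theorem3p2 lam (suc m') n k _ _ _ D = blownUp-decomposition , blownUp-vertices
  where open Blowup lam n m' k (oddDeg lam (suc m') n) D
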